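{- Let $n\ge1$ and let $\tilde\vartheta:=\varphi^{ -1}\circ\vartheta\circ\varphi:\mathcal{LT}_n\to\mathcal{LT}_n$. (i) For any $T\in\mathcal{LT}_n$, $$\mathsf{larm}(T)=\mathsf{spi}(\varphi(T)),\quad \mathsf{rev}(T)=\mathsf{rspi}(\varphi(T))\quad\text{and}\quad\mathsf{rarm}(T)=\mathsf{lrb}(\varphi(T))+1.$$ (ii) The involution $\tilde\vartheta:\mathcal{LT}_n\to\mathcal{LT}_n$ preserves the degree sequences and the statistic $\mathsf{rarm}$ but switches the statistics $\mathsf{larm}$ and $\mathsf{rev}$. (iii) Each of the statistics $\mathsf{spi},\mathsf{rspi},\mathsf{rev},\mathsf{lrb}$ interprets the triangle $T_{n,k}$: for $1\le k\le n$, $T_{n,k}$ equals the number of $B\in\mathcal{RB}_n$ with $\mathsf{spi}(B)=k$, the number of $B\in\mathcal{RB}_n$ with $\mathsf{rspi}(B)=k$, the number of $T\in\mathcal{LT}_n$ with $\mathsf{rev}(T)=k$, and the number of $B\in\mathcal{RB}_n$ with $\mathsf{lrb}(B)+1=k$.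
   Context: **Trees.** A plane tree is a rooted tree in which the children of each node are linearly ordered (left to right). A rooted labeled tree on $\{0,1,\dots,n\}$ is a plane tree with $n+1$ nodes labeled bijectively by $\{0,\dots,n\}$ such that the root is labeled $0$ and the labels of the children of any node increase from left to right; $\mathcal{LT}_n$ is the set of these. A binary tree is a rooted tree in which each node has at most one left child and at most one right child. A right increasing binary tree on $[n]=\{1,\dots,n\}$ is a binary tree with nodes labeled bijectively by $[n]$ such that the label of each right child is greater than that of its parent; $\mathcal{RB}_n$ is the set of these. **Bijection $\varphi:\mathcal{LT}_n\to\mathcal{RB}_n$.** The nodes of $\varphi(T)$ are the non-root nodes of $T$ with their labels; its root is the leftmost child of the root of $T$; for non-root nodes $x,y$, $y$ is the left child of $x$ in $\varphi(T)$ iff $y$ is the leftmost child of $x$ in $T$, and $y$ is the right child of $x$ in $\varphi(T)$ iff $x$ is the closest sibling of $y$ to its left in $T$. **Orders.** On binary trees, the preorder visits, recursively, the parent, then its left subtree, then its right subtree; on plane trees, the parent, then the subtrees of its children from left to right. The reverse preorder is the reversal of the preorder. **Map $\vartheta:\mathcal{RB}_n\to\mathcal{RB}_n$.** Let $v_i$ be the $i$-th node of $B\in\mathcal{RB}_n$ under the preorder. Then $\vartheta(B)$ has nodes $v_1,\dots,v_n$ and root $v_n$, and, for $i$ from $n-1$ down to $1$: if $v_i$ has right child $v_\ell$ in $B$, then $v_i$ is the right child of $v_\ell$ in $\vartheta(B)$; otherwise $v_i$ is the left child of $v_{i+1}$ in $\vartheta(B)$. A node is labeled $i$ in $\vartheta(B)$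 iff it is labeled $n+1-i$ in $B$. **Statistics (labels are irrelevant).** For a binary tree $B$ with $n$ nodes: $\mathsf{spi}(B)$ is the smallest $i$ such that the $(i+1)$-th node under the preorder is a right child; $\mathsf{rspi}(B)$ is the smallest $i$ such that the $(i+1)$-th node under the reverse preorder has a right child; both are $n$ by convention if $B$ has only left edges; $\mathsf{lrb}(B)$ is the number of left edges on the right boundary of $B$, i.e. the path from the root to the last node under preorder. For $T\in\mathcal{LT}_n$: $\mathsf{larm}(T)$ (resp. $\mathsf{rarm}(T)$) is the number of edges of the path starting at the root and going repeatedly to the leftmost (resp. rightmost) child until a leaf is reached; $\mathsf{rev}(T)$ is the number of nodes before the first node, under the reverse preorder, that has a younger sibling (a sibling to its right), with $\mathsf{rev}(T)=n$ by convention if $T$ is a path. The degree sequence of $T$ is the multiset of the numbers of children of its internal (non-leaf) nodes. **Triangle $T_{n,k}$.** The numbers $T_{n,k}$ ($n\ge1$, $1\le k\le n$) are defined by $$1+\sum_{n\ge1}\sum_{k=1}^nT_{n,k}t^k\frac{x^n}{n!}=\Bigl(1-t\sum_{n\ge1}(n-1)^{n-1}\frac{x^n}{n!}\Bigr)^{ -1},$$ with the convention $0^0=1$. -}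

module Defs where

open import Data.Bool.Base using (Bool; true; false; if_then_else_)
open import Data.Fin.Base using (toℕ)
open import Data.Integer.Base using (+_)
open import Data.List.Base as List
  using (List; []; _∷_; _++_; length; upTo; reverse; filter; findIndexᵇ)
open import Data.List.Membership.Propositional using () renaming (_∈_ to _∈ₗ_)
open import Data.List.Properties using (++-assoc; map-upTo)
open import Data.List.Relation.Binary.Permutation.Propositional
  using (_↭_; prep)
open import Data.List.Relation.Binary.Permutation.Propositional.Properties using (drop-∷)
open import Data.List.Relation.Unary.All using (All; []; _∷_)
open import Data.List.Relation.Unary.Linked using (Linked; []; [-]; _∷_)
open import Data.List.Relation.Unary.Unique.Propositional using (Unique)
open import Data.Maybe.Base as Maybe using (Maybe; just; nothing; fromMaybe; maybe′; _<∣>_; is-just)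
open import Data.Maybe.Relation.Unary.All as MaybeAll using (just; nothing)
open import Data.Nat.Base using (ℕ; zero; suc; _∸_; _^_; _!; _<_; _≤ᵇ_; _≡ᵇ_)
open import Data.Nat.Properties using (_≟_; _!≢0)
open import Data.Product.Base using (_×_; _,_; ∃-syntax)
open import Data.Rational.Base as ℚ using (ℚ; 0ℚ; 1ℚ; _/_)
open import Data.Rational.Properties using (+-0-monoid)
open import Algebra.Properties.Monoid.Sum +-0-monoid using (sum⁺-syntax)
open import Data.Tree.Binary using (Tree; leaf; node; mapₙ; #nodes; module Prefix)
open import Data.Unit.Base using (⊤; tt)
open import Function.Base using (id; _∘_)
open import Function.Bundles using (_⇔_)
open import Level using (0ℓ)
open import Relation.Binary.PropositionalEquality
  using (_≡_; refl; sym; trans; cong; cong₂; subst; module ≡-Reasoning)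
open import Relation.Nullary.Decidable using (¬?)
open import Relation.Unary using (Pred; _∈_)

private
  variable
    A : Set

data PlaneTree (A : Set) : Set where
  node : A → List (PlaneTree A) → PlaneTree A

Forest : Set → Set
Forest A = List (PlaneTree A)

root : PlaneTree A → A
root (node x _) = x

preorder  : PlaneTree A → List A
preorder* : Forest A → List A
preorder (node x ts) = x ∷ preorder* ts
preorder* []       = []
preorder* (t ∷ ts) = preorder t ++ preorder* ts

data SiblingsIncrease : PlaneTree ℕ → Set where
  node : ∀ {x ts} → Linked _<_ (List.map root ts) → All SiblingsIncrease ts →
         SiblingsIncrease (node x ts)

record LT (n : ℕ) (T : PlaneTree ℕ) : Set where
  constructor mkLT
  field
    root≡0   : root T ≡ 0
    labels   : preorder T ↭ upTo (suc n)
    siblings : SiblingsIncrease T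

-- leaf tt is the empty tree; the nodes of the tree in the sense of the
-- mathematics are the constructors node.
BinTree : Set → Set
BinTree A = Tree A ⊤

pattern ∅ = leaf tt

root? : BinTree A → Maybe A
root? ∅            = nothing
root? (node _ x _) = just x

data RightIncreasing : BinTree ℕ → Set where
  empty : RightIncreasing ∅
  node  : ∀ {l x r} → RightIncreasing l → MaybeAll.All (x <_) (root? r) →
          RightIncreasing r → RightIncreasing (node l x r)

record RB (n : ℕ) (B : BinTree ℕ) : Set where
  constructor mkRB
  field
    labels : Prefix.toList B ↭ List.map suc (upTo n)
    right  : RightIncreasing B

-- In φ* (t ∷ ts) the root of t receives its leftmost child as left child
-- and its next sibling, the root of the first tree of ts, as right child.
φ* : Forest A → BinTree A
φ* []               = ∅
φ* (node x cs ∷ ts) = node (φ* cs) x (φ* ts)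

φ : PlaneTree ℕ → BinTree ℕ
φ (node _ ts) = φ* ts

φ*⁻¹ : BinTree A → Forest A
φ*⁻¹ ∅            = []
φ*⁻¹ (node l x r) = node x (φ*⁻¹ l) ∷ φ*⁻¹ r

φ⁻¹ : BinTree ℕ → PlaneTree ℕ
φ⁻¹ B = node 0 (φ*⁻¹ B)

φ*∘φ*⁻¹ : (B : BinTree A) → φ* (φ*⁻¹ B) ≡ B
φ*∘φ*⁻¹ ∅            = refl
φ*∘φ*⁻¹ (node l x r) = cong₂ (λ l′ r′ → node l′ x r′) (φ*∘φ*⁻¹ l) (φ*∘φ*⁻¹ r)

φ*⁻¹∘φ* : (ts : Forest A) → φ*⁻¹ (φ* ts) ≡ ts
φ*⁻¹∘φ* []               = refl
φ*⁻¹∘φ* (node x cs ∷ ts) = cong₂ (λ cs′ ts′ → node x cs′ ∷ ts′) (φ*⁻¹∘φ* cs) (φ*⁻¹∘φ* ts)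

φ∘φ⁻¹ : ∀ B → φ (φ⁻¹ B) ≡ B
φ∘φ⁻¹ = φ*∘φ*⁻¹

φ⁻¹∘φ : ∀ {n} T → T ∈ LT n → φ⁻¹ (φ T) ≡ T
φ⁻¹∘φ (node _ ts) (mkLT refl _ _) = cong (node 0) (φ*⁻¹∘φ* ts)

private
  toDiffList-++ : ∀ (t : BinTree A) ys → Prefix.toDiffList t ys ≡ Prefix.toList t ++ ys
  toDiffList-++ ∅ ys = refl
  toDiffList-++ (node l x r) ys = cong (x ∷_) (begin
    Prefix.toDiffList l (Prefix.toDiffList r ys)    ≡⟨ toDiffList-++ l _ ⟩
    Prefix.toList l ++ Prefix.toDiffList r ys       ≡⟨ cong (Prefix.toList l ++_) (toDiffList-++ r ys) ⟩
    Prefix.toList l ++ Prefix.toList r ++ ys        ≡⟨ ++-assoc (Prefix.toList l) _ ys ⟨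
    (Prefix.toList l ++ Prefix.toList r) ++ ys      ≡⟨ cong (_++ ys) (toDiffList-++ l _) ⟨
    Prefix.toDiffList l (Prefix.toList r) ++ ys     ∎)
    where open ≡-Reasoning

  preorder-φ* : ∀ (ts : Forest A) → Prefix.toList (φ* ts) ≡ preorder* ts
  preorder-φ* []               = refl
  preorder-φ* (node x cs ∷ ts) = cong (x ∷_)
    (trans (toDiffList-++ (φ* cs) _) (cong₂ _++_ (preorder-φ* cs) (preorder-φ* ts)))

  φ*-right : ∀ ts → Linked _<_ (List.map root ts) → All SiblingsIncrease ts →
             RightIncreasing (φ* ts)
  φ*-right []                             _         _                 = empty
  φ*-right (node x cs ∷ [])               _         (node s ss ∷ _)   =
    node (φ*-right cs s ss) nothing empty
  φ*-right (node x cs ∷ ts@(node _ _ ∷ _)) (x<y ∷ s′) (node s ss ∷ ss′) =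
    node (φ*-right cs s ss) (just x<y) (φ*-right ts s′ ss′)

  φ*⁻¹-siblings : ∀ {B} → RightIncreasing B → All SiblingsIncrease (φ*⁻¹ B)
  φ*⁻¹-linked   : ∀ {B} → RightIncreasing B → Linked _<_ (List.map root (φ*⁻¹ B))
  φ*⁻¹-siblings empty        = []
  φ*⁻¹-siblings (node l _ r) = node (φ*⁻¹-linked l) (φ*⁻¹-siblings l) ∷ φ*⁻¹-siblings r
  φ*⁻¹-linked empty                      = []
  φ*⁻¹-linked (node _ _ empty) = [-]
  φ*⁻¹-linked (node _ (just x<y) r@(node _ _ _)) = x<y ∷ φ*⁻¹-linked r

  0∷-upTo : ∀ n → upTo (suc n) ≡ 0 ∷ List.map suc (upTo n)
  0∷-upTo n = cong (0 ∷_) (sym (map-upTo suc n))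

φ-RB : ∀ {n} T → T ∈ LT n → φ T ∈ RB n
φ-RB {n} (node _ ts) (mkLT refl labels (node s ss)) = mkRB
  (subst (_↭ List.map suc (upTo n)) (sym (preorder-φ* ts))
    (drop-∷ (subst (0 ∷ preorder* ts ↭_) (0∷-upTo n) labels)))
  (φ*-right ts s ss)

φ⁻¹-LT : ∀ {n} B → B ∈ RB n → φ⁻¹ B ∈ LT n
φ⁻¹-LT {n} B (mkRB labels right) = mkLT refl
  (subst (0 ∷ preorder* (φ*⁻¹ B) ↭_) (sym (0∷-upTo n)) (prep 0
    (subst (_↭ List.map suc (upTo n))
      (trans (cong Prefix.toList (sym (φ*∘φ*⁻¹ B))) (preorder-φ* (φ*⁻¹ B))) labels)))
  (node (φ*⁻¹-linked right) (φ*⁻¹-siblings right))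

-- Nodes are identified by their labels, which are distinct in a tree of
-- RB n.
rightChild : BinTree ℕ → ℕ → Maybe ℕ
rightChild ∅            v = nothing
rightChild (node l x r) v =
  if x ≡ᵇ v then root? r else rightChild l v <∣> rightChild r v

-- attachLeft p v t makes the new node v the left child of the node p of t.
-- The branch at p overwrites the old left subtree, but in the construction
-- below that subtree is always empty; likewise for attachRight.
attachLeft : ℕ → ℕ → BinTree ℕ → BinTree ℕ
attachLeft p v ∅            = ∅
attachLeft p v (node l x r) =
  if x ≡ᵇ p then node (node ∅ v ∅) x r
            else node (attachLeft p v l) x (attachLeft p v r)

attachRight : ℕ → ℕ → BinTree ℕ → BinTree ℕ
attachRight p v ∅            = ∅
attachRight p v (node l x r) =
  if x ≡ᵇ p then node l x (node ∅ v ∅)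
            else node (attachRight p v l) x (attachRight p v r)

-- Inserts v = vᵢ into the partial tree t on vᵢ₊₁, …, vₙ, where w = vᵢ₊₁.
insert : BinTree ℕ → ℕ → ℕ → BinTree ℕ → BinTree ℕ
insert B v w t =
  maybe′ (λ u → attachRight u v t) (attachLeft w v t) (rightChild B v)

-- On the list of nodes of B in preorder: start from the root vₙ and insert
-- vₙ₋₁, …, v₁ in turn.
build : BinTree ℕ → List ℕ → BinTree ℕ
build B []               = ∅
build B (v ∷ [])         = node ∅ v ∅
build B (v ∷ vs@(w ∷ _)) = insert B v w (build B vs)

-- The relabeling is i ↦ n + 1 - i.
ϑ : BinTree ℕ → BinTree ℕ
ϑ B = mapₙ (suc (#nodes B) ∸_) (build B (Prefix.toList B))

ϑ̃ : PlaneTree ℕ → PlaneTree ℕ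
ϑ̃ = φ⁻¹ ∘ ϑ ∘ φ

-- The least i such that the (i+1)-th entry is true.
firstTrue : List Bool → Maybe ℕ
firstTrue bs = Maybe.map toℕ (findIndexᵇ id bs)

-- The Boolean argument tells whether the root of the given tree is itself
-- a right child in the ambient tree.
markRightChildren : Bool → BinTree A → BinTree Bool
markRightChildren b ∅            = ∅
markRightChildren b (node l _ r) =
  node (markRightChildren false l) b (markRightChildren true r)

markHasRightChild : BinTree A → BinTree Bool
markHasRightChild ∅            = ∅
markHasRightChild (node l _ r) =
  node (markHasRightChild l) (is-just (root? r)) (markHasRightChild r)

spi : BinTree A → ℕ
spi B = fromMaybe (#nodes B) (firstTrue (Prefix.toList (markRightChildren false B)))

rspi : BinTree A → ℕ
rspi B = fromMaybe (#nodes B) (firstTrue (reverse (Prefix.toList (markHasRightChild B))))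

-- The last node in preorder lies in the right subtree if there is one, and
-- otherwise in the left subtree if there is one.
lrb : BinTree A → ℕ
lrb ∅                       = 0
lrb (node _ _ r@(node _ _ _)) = lrb r
lrb (node l@(node _ _ _) _ ∅) = suc (lrb l)
lrb (node ∅ _ ∅)            = 0

larm : PlaneTree A → ℕ
larm (node _ [])      = 0
larm (node _ (t ∷ _)) = suc (larm t)

rarm     : PlaneTree A → ℕ
rarmLast : PlaneTree A → Forest A → ℕ
rarm (node _ [])       = 0
rarm (node _ (t ∷ ts)) = suc (rarmLast t ts)
rarmLast t []       = rarm t
rarmLast _ (u ∷ us) = rarmLast u us

-- The Boolean argument tells whether the root of the given tree has itself a
-- younger sibling in the ambient tree.
markHasYounger  : Bool → PlaneTree A → PlaneTree Bool
markHasYounger* : Forest A → Forest Bool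
markHasYounger b (node _ ts) = node b (markHasYounger* ts)
markHasYounger* []             = []
markHasYounger* (t ∷ [])       = markHasYounger false t ∷ []
markHasYounger* (t ∷ ts@(_ ∷ _)) = markHasYounger true t ∷ markHasYounger* ts

#edges : PlaneTree A → ℕ
#edges T = length (preorder T) ∸ 1

rev : PlaneTree A → ℕ
rev T = fromMaybe (#edges T) (firstTrue (reverse (preorder (markHasYounger false T))))

degrees  : PlaneTree A → List ℕ
degrees* : Forest A → List ℕ
degrees (node _ ts) = length ts ∷ degrees* ts
degrees* []       = []
degrees* (t ∷ ts) = degrees t ++ degrees* ts

-- A multiset, represented by a list up to permutation.
degreeSequence : PlaneTree A → List ℕ
degreeSequence T = filter (λ d → ¬? (d ≟ 0)) (degrees T)

-- Formal power series in x and t over ℚ: f n k is the coefficient of xⁿ tᵏ.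
Series : Set
Series = ℕ → ℕ → ℚ

infixl 6 _⊖_
infixl 7 _⊛_

_⊖_ : Series → Series → Series
(f ⊖ g) n k = f n k ℚ.- g n k

_⊛_ : Series → Series → Series
(f ⊛ g) n k =
  ∑[ i ≤ n ] ∑[ j ≤ k ] (f (toℕ i) (toℕ j) ℚ.* g (n ∸ toℕ i) (k ∸ toℕ j))

𝟙 : Series
𝟙 zero zero = 1ℚ
𝟙 _    _    = 0ℚ

infixl 7 _/!_

_/!_ : ℚ → ℕ → ℚ
q /! n = q ℚ.* ((+ 1) / n !) {{n !≢0}}

-- t Σ_{n≥1} (n-1)ⁿ⁻¹ xⁿ/n!
tA : Series
tA (suc m) 1 = ((+ (m ^ m)) / 1) /! suc m
tA _       _ = 0ℚ

-- 1 + Σ_{n≥1} Σ_{1≤k≤n} T n k tᵏ xⁿ/n!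
genFun : (ℕ → ℕ → ℚ) → Series
genFun T zero    zero    = 1ℚ
genFun T zero    (suc _) = 0ℚ
genFun T (suc n) zero    = 0ℚ
genFun T (suc n) (suc k) = if suc k ≤ᵇ suc n then T (suc n) (suc k) /! suc n else 0ℚ

-- genFun T is the multiplicative inverse of 1 - tA. As 1 - tA has constant
-- term 1, this determines T n k for 1 ≤ k ≤ n.
IsTriangle : (ℕ → ℕ → ℚ) → Set
IsTriangle T = ∀ n k → (genFun T ⊛ (𝟙 ⊖ tA)) n k ≡ 𝟙 n k

_HasSize_ : Pred A 0ℓ → ℕ → Set
P HasSize c = ∃[ xs ] (Unique xs × (∀ x → (x ∈ₗ xs) ⇔ P x) × length xs ≡ c)

_Counts_ : ℚ → Pred A 0ℓ → Set
q Counts P = ∃[ c ] (P HasSize c × q ≡ (+ c) / 1)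

{-# OPTIONS --safe #-}

-- The insertion procedure defining ϑ has a recursive description: after the
-- relabeling is undone, every family of siblings of the plane tree is reversed,
-- the child forest of each sibling but the last moves to the sibling on its
-- right, and the families on the rightmost path are linked in the opposite
-- order. Involutivity and the behaviour of the statistics follow by structural
-- induction on this description.
--
-- Cutting the leftmost (or rightmost) path after its first edge decomposes a
-- tree into a smaller tree, whose path is shorter by one, and a forest whose
-- first (or last) root has no children. Removing the roots of a forest shows, by
-- the binomial theorem, that there are y(y+m)^(m-1) tuples of y forests on m
-- labels, and then, by a telescoping argument, (m-1)^(m-1) forests of the latter
-- kind on m labels. So both path lengths are distributed by the coefficients of
-- the powers of Σ (m-1)^(m-1) xᵐ/m!, and ϑ and φ transport this to the other
-- statistics.
module Submission where

open import Defs
open import Algebra.Bundles using (CommutativeRing)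
open import Data.Bool.Base using (Bool; true; false; if_then_else_; T)
open import Data.Empty using (⊥; ⊥-elim)
open import Data.Fin.Base using (toℕ)
open import Data.Fin.Properties using (toℕ≤pred[n])
import Data.Integer.Base as ℤ
import Data.Integer.Properties as ℤ
open import Data.Integer.Tactic.RingSolver using () renaming (solve-∀ to solve-∀ᶻ)
open import Data.List.Base as List
  using (List; []; _∷_; _++_; _∷ʳ_; length; concat; concatMap; replicate; reverse; upTo;
         applyUpTo; applyDownFrom; findIndexᵇ)
open import Data.List.Membership.Propositional using (_∉_) renaming (_∈_ to _∈ₗ_)
open import Data.List.Membership.Propositional.Properties using (∈-++⁺ˡ; ∈-++⁺ʳ; ∈-++⁻; ∈-∃++)
open import Data.List.Properties
  using (++-assoc; ++-identityʳ; length-++; length-map; length-upTo; length-reverse; length-replicate;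
         map-++; map-∘; map-upTo; reverse-++; reverse-applyUpTo; unfold-reverse;
         ∷-injective; ∷-injectiveʳ; ∷ʳ-injective)
open import Data.List.Relation.Binary.Permutation.Propositional
  using (_↭_; ↭-refl; ↭-reflexive; ↭-sym; ↭-trans; ↭⇒↭ₛ; prep; swap; module PermutationReasoning)
open import Data.List.Relation.Binary.Permutation.Propositional.Properties as ↭
  using (++-commutativeMonoid; ++⁺; ++⁺ˡ; ++⁺ʳ; shift; shifts; drop-∷; ∷↭∷ʳ; All-resp-↭; ∈-resp-↭;
         ↭-length; ↭-empty-inv; ↭-reverse; filter-↭)
open import Data.List.Relation.Binary.Pointwise as Pointwise using (Pointwise; []; _∷_)
open import Data.List.Relation.Ternary.Interleaving.Propositional as Interleaving
  using (Interleaving; []; consˡ; consʳ; toPermutation)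
open import Data.List.Relation.Unary.All as All using (All; []; _∷_)
import Data.List.Relation.Unary.All.Properties as All
open import Data.List.Relation.Unary.AllPairs as AllPairs using ([]; _∷_)
open import Data.List.Relation.Unary.Any using (here; there)
open import Data.List.Relation.Unary.Linked as Linked using (Linked; []; _∷_)
open import Data.List.Relation.Unary.Linked.Properties as Linked using (Linked⇒AllPairs; AllPairs⇒Linked)
open import Data.List.Relation.Unary.Sorted.TotalOrder.Properties using (↗↭↗⇒≋)
open import Data.List.Relation.Unary.Unique.Propositional using (Unique)
import Data.List.Relation.Unary.Unique.Propositional.Properties as Unique
open import Data.Maybe.Base as Maybe using (Maybe; just; nothing; fromMaybe; maybe′; _<∣>_; is-just)
import Data.Maybe.Properties as Maybe
open import Data.Maybe.Relation.Unary.All as MaybeAll using (just; nothing)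
open import Data.Nat.Base
open import Data.Nat.Properties
open import Data.Nat.Tactic.RingSolver using (solve-∀)
open import Data.Product.Base using (_×_; _,_; ∃; ∃₂; proj₁; proj₂)
open import Data.Rational.Base as ℚ using (ℚ; 0ℚ; 1ℚ; fromℚᵘ)
import Data.Rational.Properties as ℚ
open import Data.Rational.Solver using () renaming (module +-*-Solver to ℚ-Solver)
open import Data.Rational.Unnormalised.Base as ℚᵘ using (mkℚᵘ; *≡*)
import Data.Rational.Unnormalised.Properties as ℚᵘ
open import Data.Sum.Base using (inj₁; inj₂; [_,_]′)
open import Data.Tree.Binary using (node; mapₙ; #nodes; module Prefix)
open import Data.Tree.Binary.Properties using (map-compose)
open import Data.Unit.Base using (⊤; tt)
open import Function.Base using (id; _∘_; case_of_)
open import Function.Bundles using (_⇔_; mk⇔; module Equivalence)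
open import Level using (0ℓ)
open import Relation.Binary.PropositionalEquality
open import Relation.Nullary using (¬_; contradiction)
open import Relation.Nullary.Decidable using (¬?)
open import Relation.Unary using (Pred; _∈_; _∪_)

open import Algebra.Properties.Semiring.Sum (CommutativeRing.semiring ℚ.+-*-commutativeRing)
  using (sum⁺-syntax; sum-cong-≗; *-distribˡ-sum; ∑-distrib-+)
open import Algebra.Solver.CommutativeMonoid (++-commutativeMonoid {A = ℕ}) using (_⊕_; _⊜_) renaming (solve to ++-solve)
open import Data.List.Relation.Binary.Permutation.Setoid.Properties (setoid ℕ) using (Unique-resp-↭)

-- On the side of ϑ the obstacle is that `insert` finds nodes by their labels in one global tree, so
-- the procedure shows no recursion on subtrees. `build-++` therefore treats a subtree as a segment
-- of the preorder together with a context for what the later nodes have already produced; distinct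
-- labels let attachments pass through contexts. The resulting recursion carries two accumulators
-- `L` and `R`, and the claims about ϑ are proved by inductions that generalise over them. On the
-- side of counting, a set of labels is an increasing list and a choice of a subset is an
-- interleaving, so that equal labelled objects are literally equal. The number (m-1)^(m-1) arises
-- because the root on the arm gives up its child forest: a family with k roots has only k - 1 free
-- child forests, which shifts the argument in the count of tuples by one. `rev` and `rspi` get no
-- decomposition of their own; the involution trades them for `larm`.

private
  variable
    A B : Set
    c d : ℕ

-- Cardinalities of finite sets

∈-pointwise : ∀ {R : A → B → Set} {xs ys x} → Pointwise R xs ys → x ∈ₗ xs →
              ∃ λ y → y ∈ₗ ys × R x y
∈-pointwise (r ∷ rs) (here refl) = _ , here refl , r
∈-pointwise (r ∷ rs) (there x∈xs) with ∈-pointwise rs x∈xs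
... | y , y∈ys , r′ = y , there y∈ys , r′

-- The bijection is a relation instead of a pair of maps because the decompositions below are
-- characterised by equations such as `roots ts ≡ ks`. Choosing a partner for each listed element
-- yields the new list, and injectivity keeps it free of repetitions.
HasSize-correspondence :
  {P : Pred A 0ℓ} {Q : Pred B 0ℓ} (R : A → B → Set) →
  (∀ {a} → P a → ∃ λ b → Q b × R a b) →
  (∀ {b} → Q b → ∃ λ a → P a × R a b) →
  (∀ {a b b′} → P a → Q b → Q b′ → R a b → R a b′ → b ≡ b′) →
  (∀ {a a′ b} → P a → P a′ → Q b → R a b → R a′ b → a ≡ a′) →
  P HasSize c → Q HasSize c
HasSize-correspondence {c = c} {P} {Q} R total surjective functional injective (xs , uniq , mem , size) =
  ys , unique rs uniq , members , trans (sym (Pointwise.Pointwise-length rs)) size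
  where
  R′ = λ a b → P a × Q b × R a b

  choose : ∀ xs → All P xs → ∃ (Pointwise R′ xs)
  choose []       []       = [] , []
  choose (x ∷ xs) (p ∷ ps) with total p | choose xs ps
  ... | y , q , r | ys , rs = y ∷ ys , (p , q , r) ∷ rs

  chosen = choose xs (All.tabulate (λ {x} → Equivalence.to (mem x)))
  ys = proj₁ chosen
  rs = proj₂ chosen

  unique : ∀ {xs ys} → Pointwise R′ xs ys → Unique xs → Unique ys
  unique [] [] = []
  unique {xs = x ∷ xs} {y ∷ ys} ((p , q , r) ∷ rs) (x≢ ∷ u) = All.tabulate fresh ∷ unique rs u
    where
    fresh : ∀ {z} → z ∈ₗ ys → y ≢ z
    fresh z∈ys refl with ∈-pointwise (Pointwise.symmetric id rs) z∈ys
    ... | x′ , x′∈xs , p′ , _ , r′ = All.lookup x≢ x′∈xs (injective p p′ q r r′)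

  members : ∀ y → y ∈ₗ ys ⇔ Q y
  members y = mk⇔
    (λ y∈ys → case ∈-pointwise (Pointwise.symmetric id rs) y∈ys of λ { (_ , _ , _ , q , _) → q })
    (λ q → from-Q q (surjective q))
    where
    from-Q : Q y → (∃ λ a → P a × R a y) → y ∈ₗ ys
    from-Q q (a , p , r) with ∈-pointwise rs (Equivalence.from (mem a) p)
    ... | y′ , y′∈ys , _ , q′ , r′ = subst (_∈ₗ ys) (functional p q′ q r′ r) y′∈ys

HasSize-cong : {P Q : Pred A 0ℓ} → (∀ {a} → P a → Q a) → (∀ {a} → Q a → P a) →
               P HasSize c → Q HasSize c
HasSize-cong to from (xs , uniq , mem , size) =
  xs , uniq , (λ x → mk⇔ (to ∘ Equivalence.to (mem x)) (Equivalence.from (mem x) ∘ from)) , size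

HasSize-∅ : {P : Pred A 0ℓ} → (∀ {a} → ¬ P a) → P HasSize 0
HasSize-∅ ¬p = [] , [] , (λ x → mk⇔ (λ ()) (λ p → ⊥-elim (¬p p))) , refl

HasSize-singleton : {P : Pred A 0ℓ} (a : A) → P a → (∀ {b} → P b → b ≡ a) → P HasSize 1
HasSize-singleton a p only = a ∷ [] , [] ∷ [] ,
  (λ x → mk⇔ (λ { (here refl) → p }) (here ∘ only)) , refl

HasSize-∪ : {P Q : Pred A 0ℓ} → (∀ {a} → P a → ¬ Q a) →
            P HasSize c → Q HasSize d → (P ∪ Q) HasSize (c + d)
HasSize-∪ disjoint (xs , ux , mx , sx) (ys , uy , my , sy) =
  xs ++ ys ,
  Unique.++⁺ ux uy (λ { (x∈xs , x∈ys) → disjoint (Equivalence.to (mx _) x∈xs) (Equivalence.to (my _) x∈ys) }) ,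
  (λ x → mk⇔
    ([ inj₁ ∘ Equivalence.to (mx x) , inj₂ ∘ Equivalence.to (my x) ]′ ∘ ∈-++⁻ xs)
    [ ∈-++⁺ˡ ∘ Equivalence.from (mx x) , ∈-++⁺ʳ xs ∘ Equivalence.from (my x) ]′) ,
  trans (length-++ xs) (cong₂ _+_ sx sy)

HasSize-image : {P : Pred A 0ℓ} (f : A → B) → (∀ {a a′} → f a ≡ f a′ → a ≡ a′) →
                P HasSize c → (λ b → ∃ λ a → P a × b ≡ f a) HasSize c
HasSize-image f injective = HasSize-correspondence (λ a b → b ≡ f a)
  (λ p → _ , (_ , p , refl) , refl)
  id
  (λ _ _ _ b≡ b′≡ → trans b≡ (sym b′≡))
  (λ _ _ _ b≡ b≡′ → injective (trans (sym b≡) b≡′))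

HasSize-× : {P : Pred A 0ℓ} {Q : A → Pred B 0ℓ} →
            P HasSize c → (∀ {a} → P a → Q a HasSize d) →
            (λ (a , b) → P a × Q a b) HasSize (c * d)
HasSize-× {d = d} {P} {Q} (xs , uniq , mem , refl) sizes =
  -- Membership in the list replaces `P`, so that the induction can run over the list.
  HasSize-cong (λ { {a , _} (a∈ , q) → Equivalence.to (mem a) a∈ , q })
               (λ { {a , _} (p , q) → Equivalence.from (mem a) p , q })
               (fibres xs uniq (λ {a} a∈ → sizes (Equivalence.to (mem a) a∈)))
  where
  fibres : ∀ xs → Unique xs → (∀ {a} → a ∈ₗ xs → Q a HasSize d) →
           (λ (a , b) → a ∈ₗ xs × Q a b) HasSize (length xs * d)
  fibres []       _           _     = HasSize-∅ λ ()
  fibres (x ∷ xs) (x∉ ∷ uniq) sizes = HasSize-cong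
    (λ { (inj₁ (_ , q , refl)) → here refl , q ; (inj₂ (a∈ , q)) → there a∈ , q })
    (λ { (here refl , q) → inj₁ (_ , q , refl) ; (there a∈ , q) → inj₂ (a∈ , q) })
    (HasSize-∪ (λ { (_ , _ , refl) (a∈ , _) → All.lookup x∉ a∈ refl })
      (HasSize-image (x ,_) (λ { refl → refl }) (sizes (here refl)))
      (fibres xs uniq (sizes ∘ there)))

HasSize-bijection : {P : Pred A 0ℓ} {Q : Pred B 0ℓ} (f : A → B) (g : B → A) →
  (∀ {a} → P a → Q (f a)) → (∀ {b} → Q b → P (g b)) →
  (∀ {a} → P a → g (f a) ≡ a) → (∀ {b} → Q b → f (g b) ≡ b) →
  P HasSize c → Q HasSize c
HasSize-bijection f g to from gf fg = HasSize-correspondence (λ a b → f a ≡ b)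
  (λ p → f _ , to p , refl)
  (λ q → g _ , from q , fg q)
  (λ _ _ _ eq eq′ → trans (sym eq) eq′)
  (λ p p′ _ eq eq′ → trans (sym (gf p)) (trans (cong g (trans eq (sym eq′))) (gf p′)))

-- Binomial sums

-- Σᵢ₊ⱼ₌ₙ (n choose i) g i j, by Pascal's rule
binomSum : ℕ → (ℕ → ℕ → ℕ) → ℕ
binomSum zero    g = g 0 0
binomSum (suc n) g = binomSum n (λ i j → g (suc i) j) + binomSum n (λ i j → g i (suc j))

binomSum-cong : ∀ n {f g} → (∀ i j → i + j ≡ n → f i j ≡ g i j) → binomSum n f ≡ binomSum n g
binomSum-cong zero    f≡g = f≡g 0 0 refl
binomSum-cong (suc n) f≡g = cong₂ _+_
  (binomSum-cong n λ i j i+j≡n → f≡g (suc i) j (cong suc i+j≡n))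
  (binomSum-cong n λ i j i+j≡n → f≡g i (suc j) (trans (+-suc i j) (cong suc i+j≡n)))

binomSum-*ʳ : ∀ n k f → binomSum n (λ i j → f i j * k) ≡ binomSum n f * k
binomSum-*ʳ zero    k f = refl
binomSum-*ʳ (suc n) k f = trans (cong₂ _+_ (binomSum-*ʳ n k _) (binomSum-*ʳ n k _)) (sym (*-distribʳ-+ k (binomSum n _) _))

binomial-theorem : ∀ n a b → binomSum n (λ i j → a ^ i * b ^ j) ≡ (a + b) ^ n
binomial-theorem zero    a b = refl
binomial-theorem (suc n) a b = begin
  binomSum n (λ i j → a ^ suc i * b ^ j) + binomSum n (λ i j → a ^ i * b ^ suc j)
    ≡⟨ cong₂ _+_ (binomSum-cong n λ i j _ → rotateˡ a (a ^ i) (b ^ j)) (binomSum-cong n λ i j _ → rotateʳ b (a ^ i) (b ^ j)) ⟩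
  binomSum n (λ i j → a ^ i * b ^ j * a) + binomSum n (λ i j → a ^ i * b ^ j * b)
    ≡⟨ cong₂ _+_ (binomSum-*ʳ n a _) (binomSum-*ʳ n b _) ⟩
  binomSum n (λ i j → a ^ i * b ^ j) * a + binomSum n (λ i j → a ^ i * b ^ j) * b
    ≡⟨ *-distribˡ-+ (binomSum n _) a b ⟨
  binomSum n (λ i j → a ^ i * b ^ j) * (a + b)
    ≡⟨ *-comm (binomSum n _) (a + b) ⟩
  (a + b) * binomSum n (λ i j → a ^ i * b ^ j)
    ≡⟨ cong ((a + b) *_) (binomial-theorem n a b) ⟩
  (a + b) ^ suc n ∎
  where
  open ≡-Reasoning
  rotateˡ : ∀ x y z → x * y * z ≡ y * z * x
  rotateˡ x y z = trans (*-assoc x y z) (*-comm x (y * z))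
  rotateʳ : ∀ x y z → y * (x * z) ≡ y * z * x
  rotateʳ x y z = trans (cong (y *_) (*-comm x z)) (sym (*-assoc y z x))

binomSum-*ˡ : ∀ n k f → binomSum n (λ i j → k * f i j) ≡ k * binomSum n f
binomSum-*ˡ zero    k f = refl
binomSum-*ˡ (suc n) k f = trans (cong₂ _+_ (binomSum-*ˡ n k _) (binomSum-*ˡ n k _)) (sym (*-distribˡ-+ k (binomSum n _) _))

binomSum-+ : ∀ n f g → binomSum n (λ i j → f i j + g i j) ≡ binomSum n f + binomSum n g
binomSum-+ zero    f g = refl
binomSum-+ (suc n) f g = trans (cong₂ _+_ (binomSum-+ n _ _) (binomSum-+ n _ _)) (exchange (binomSum n _) (binomSum n _) (binomSum n _) (binomSum n _))
  where
  exchange : ∀ a b c d → a + b + (c + d) ≡ a + c + (b + d)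
  exchange = solve-∀

binomSum-zero : ∀ n → binomSum n (λ _ _ → 0) ≡ 0
binomSum-zero zero    = refl
binomSum-zero (suc n) = cong₂ _+_ (binomSum-zero n) (binomSum-zero n)

-- Supplies the boundary term at `i ≡ 0` of the telescoping identity in `binomSum-families`.
onlyLeft₀ : (ℕ → ℕ) → ℕ → ℕ → ℕ
onlyLeft₀ g zero    j = g j
onlyLeft₀ g (suc _) _ = 0

binomSum-onlyLeft₀ : ∀ n g → binomSum n (onlyLeft₀ g) ≡ g n
binomSum-onlyLeft₀ zero    g = refl
binomSum-onlyLeft₀ (suc n) g = cong₂ _+_ (binomSum-zero n)
  (trans (binomSum-cong n λ { zero _ _ → refl ; (suc _) _ _ → refl }) (binomSum-onlyLeft₀ n (λ j → g (suc j))))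

-- i (n+1 choose i) = (n+1) (n choose i-1)
binomSum-absorption : ∀ n (g : ℕ → ℕ → ℕ) → binomSum (suc n) (λ i j → i * g i j) ≡ suc n * binomSum n (λ i j → g (suc i) j)
binomSum-absorption zero    g = +-identityʳ _
binomSum-absorption (suc n) g = begin
  binomSum (suc n) (λ i j → g (suc i) j + i * g (suc i) j) + binomSum (suc n) (λ i j → i * g i (suc j))
    ≡⟨ cong₂ _+_ (binomSum-+ (suc n) (λ i j → g (suc i) j) (λ i j → i * g (suc i) j))
                (binomSum-absorption n (λ i j → g i (suc j))) ⟩
  binomSum (suc n) (λ i j → g (suc i) j) + binomSum (suc n) (λ i j → i * g (suc i) j) + suc n * b
    ≡⟨ cong (λ z → a + b + z + suc n * b) (binomSum-absorption n (λ i j → g (suc i) j)) ⟩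
  a + b + suc n * a + suc n * b
    ≡⟨ collect a b n ⟩
  suc (suc n) * (a + b) ∎
  where
  open ≡-Reasoning
  a = binomSum n (λ i j → g (suc (suc i)) j)
  b = binomSum n (λ i j → g (suc i) (suc j))
  collect : ∀ a b n → a + b + suc n * a + suc n * b ≡ suc (suc n) * (a + b)
  collect = solve-∀

-- The Abel polynomial y(y+m)^(m-1). The case m = 0 stands apart because its exponent would be -1;
-- its value 1 counts the tuple of empty forests, also for y = 0.
#forestTuples : ℕ → ℕ → ℕ
#forestTuples zero    y = 1
#forestTuples (suc m) y = y * (y + suc m) ^ m

-- The factor n = k + r raises the exponent r - 1 to r, which removes the case distinction and
-- prepares the absorption identity.
*-#forestTuples : ∀ n k r → k + r ≡ n → n * #forestTuples r k ≡ k * n ^ r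
*-#forestTuples n k zero    refl = cong (_* 1) (+-identityʳ k)
*-#forestTuples n k (suc r) refl = exchange (k + suc r) k ((k + suc r) ^ r)
  where
  exchange : ∀ x y z → x * (y * z) ≡ y * (x * z)
  exchange = solve-∀

-- This is the recursion by root levels: k roots in y colours, then k child forests on the other r
-- labels. After multiplication by n the summand is k y^k n^r; absorbing the factor k leaves y times
-- a binomial expansion of (y+n)^m.
binomSum-#forestTuples : ∀ m y → binomSum (suc m) (λ k r → y ^ k * #forestTuples r k) ≡ #forestTuples (suc m) y
binomSum-#forestTuples m y = *-cancelˡ-≡ _ _ n (begin
  n * binomSum n (λ k r → y ^ k * #forestTuples r k)
    ≡⟨ binomSum-*ˡ n n (λ k r → y ^ k * #forestTuples r k) ⟨
  binomSum n (λ k r → n * (y ^ k * #forestTuples r k))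
    ≡⟨ binomSum-cong n (λ k r k+r≡n → trans (exchange n (y ^ k) _)
         (trans (cong (y ^ k *_) (*-#forestTuples n k r k+r≡n)) (exchange (y ^ k) k (n ^ r)))) ⟩
  binomSum n (λ k r → k * (y ^ k * n ^ r))
    ≡⟨ binomSum-absorption m (λ k r → y ^ k * n ^ r) ⟩
  n * binomSum m (λ k r → y * y ^ k * n ^ r)
    ≡⟨ cong (n *_) (binomSum-cong m λ k r _ → *-assoc y (y ^ k) (n ^ r)) ⟩
  n * binomSum m (λ k r → y * (y ^ k * n ^ r))
    ≡⟨ cong (n *_) (binomSum-*ˡ m y _) ⟩
  n * (y * binomSum m (λ k r → y ^ k * n ^ r))
    ≡⟨ cong (λ z → n * (y * z)) (binomial-theorem m y n) ⟩
  n * (y * (y + n) ^ m) ∎)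
  where
  open ≡-Reasoning
  n = suc m
  exchange : ∀ x y z → x * (y * z) ≡ y * (x * z)
  exchange = solve-∀

-- The sizes of `Family`: one of the `suc k` roots lies on the arm, and the other `k` have child
-- forests on the remaining `r` labels.
families : ℕ → ℕ → ℕ
families zero    _ = 0
families (suc k) r = #forestTuples r k

#arms : ℕ → ℕ
#arms zero    = 0
#arms (suc m) = m ^ m

-- For k ≥ 1 one has m * families k r = (k - 1) m^r. Adding m^r to every term avoids the subtraction
-- and leaves k m^r, plus a boundary term m^n from k = 0. The two sums that remain, of m^r and of k
-- m^r, both equal n^n and cancel. Finally m is cancelled, so n = 1 is treated separately.
binomSum-families : ∀ n → binomSum n families ≡ #arms n
binomSum-families zero       = refl
binomSum-families (suc zero) = refl
binomSum-families (suc m@(suc _)) = *-cancelˡ-≡ _ _ m (+-cancelʳ-≡ (n ^ n) _ _ (begin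
  m * binomSum n families + n ^ n
    ≡⟨ cong₂ _+_ (sym (binomSum-*ˡ n m families)) (sym (powers n)) ⟩
  binomSum n (λ k r → m * families k r) + binomSum n (λ _ r → m ^ r)
    ≡⟨ binomSum-+ n (λ k r → m * families k r) (λ _ r → m ^ r) ⟨
  binomSum n (λ k r → m * families k r + m ^ r)
    ≡⟨ binomSum-cong n termwise ⟩
  binomSum n (λ k r → onlyLeft₀ (m ^_) k r + k * m ^ r)
    ≡⟨ binomSum-+ n (onlyLeft₀ (m ^_)) (λ k r → k * m ^ r) ⟩
  binomSum n (onlyLeft₀ (m ^_)) + binomSum n (λ k r → k * m ^ r)
    ≡⟨ cong₂ _+_ (binomSum-onlyLeft₀ n (m ^_)) (binomSum-absorption m (λ _ r → m ^ r)) ⟩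
  m * m ^ m + n * binomSum m (λ _ r → m ^ r)
    ≡⟨ cong (λ z → m * m ^ m + n * z) (powers m) ⟩
  m * m ^ m + n ^ n ∎))
  where
  open ≡-Reasoning
  n = suc m
  powers : ∀ i → binomSum i (λ _ r → m ^ r) ≡ n ^ i
  powers i = trans (binomSum-cong i λ k r _ → sym (trans (cong (_* m ^ r) (^-zeroˡ k)) (*-identityˡ _)))
                   (binomial-theorem i 1 m)
  termwise : ∀ k r → k + r ≡ n → m * families k r + m ^ r ≡ onlyLeft₀ (m ^_) k r + k * m ^ r
  termwise zero    r _      = trans (cong (_+ m ^ r) (*-zeroʳ m)) (sym (+-identityʳ _))
  termwise (suc k) r k+r≡m = trans (cong (_+ m ^ r) (*-#forestTuples m k r (suc-injective k+r≡m)))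
                                   (+-comm _ (m ^ r))

-- Splitting and colouring sets of labels

-- An interleaving keeps the order of `xs`, so when `xs` has no repetitions each distribution of its
-- labels occurs exactly once.
Splits : List ℕ → (List ℕ → List ℕ → Pred B 0ℓ) → Pred ((List ℕ × List ℕ) × B) 0ℓ
Splits xs Q ((ys , zs) , b) = Interleaving ys zs xs × Q ys zs b

Interleaving-∈ʳ : ∀ {x : A} {xs ys zs} → Interleaving ys zs xs → x ∈ₗ zs → x ∈ₗ xs
Interleaving-∈ʳ {ys = ys} i = ∈-resp-↭ (↭-sym (toPermutation i)) ∘ ∈-++⁺ʳ ys

-- Sending the first label to the left or to the right is the recursion of `binomSum`. The two cases
-- are disjoint because this label does not recur in the tail.
HasSize-splits : ∀ {xs} → Unique xs → ∀ {Q : List ℕ → List ℕ → Pred B 0ℓ} {g} →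
  (∀ {ys zs} → Interleaving ys zs xs → Q ys zs HasSize g (length ys) (length zs)) →
  Splits xs Q HasSize binomSum (length xs) g
HasSize-splits [] {Q} sizes = HasSize-cong
  (λ { (_ , q , refl) → [] , q }) (λ { ([] , q) → _ , q , refl })
  (HasSize-image (([] , []) ,_) (λ { refl → refl }) (sizes []))
HasSize-splits {B = B} {xs = x ∷ xs} (x∉ ∷ uniq) {Q} sizes = HasSize-cong
  (λ { (inj₁ (_ , (i , q) , refl)) → consˡ i , q
     ; (inj₂ (_ , (i , q) , refl)) → consʳ i , q })
  (λ { (consˡ i , q) → inj₁ (_ , (i , q) , refl)
     ; (consʳ i , q) → inj₂ (_ , (i , q) , refl) })
  (HasSize-∪
    (λ { (_ , _ , refl) (_ , (i , _) , refl) →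
         All.lookup x∉ (Interleaving-∈ʳ (Interleaving.swap i) (here refl)) refl })
    (HasSize-image intoLeft (λ { {_ , _} {_ , _} refl → refl })
      (HasSize-splits uniq {λ ys zs → Q (x ∷ ys) zs} (sizes ∘ consˡ)))
    (HasSize-image intoRight (λ { {_ , _} {_ , _} refl → refl })
      (HasSize-splits uniq {λ ys zs → Q ys (x ∷ zs)} (sizes ∘ consʳ))))
  where
  intoLeft intoRight : (List ℕ × List ℕ) × B → (List ℕ × List ℕ) × B
  intoLeft ((ys , zs) , b) = (x ∷ ys , zs) , b
  intoRight ((ys , zs) , b) = (ys , x ∷ zs) , b

Increasing : List ℕ → Set
Increasing = Linked _<_

Increasing-∷⁻ : ∀ {x xs} → Increasing (x ∷ xs) → All (x <_) xs × Increasing xs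
Increasing-∷⁻ inc with Linked⇒AllPairs <-trans inc
... | x< ∷ ap = x< , AllPairs⇒Linked ap

Increasing-∷⁺ : ∀ {x xs} → All (x <_) xs → Increasing xs → Increasing (x ∷ xs)
Increasing-∷⁺ x< inc = AllPairs⇒Linked (x< ∷ Linked⇒AllPairs <-trans inc)

Increasing⇒Unique : ∀ {xs} → Increasing xs → Unique xs
Increasing⇒Unique = AllPairs.map <⇒≢ ∘ Linked⇒AllPairs <-trans

Increasing-↭⇒≡ : ∀ {xs ys} → Increasing xs → Increasing ys → xs ↭ ys → xs ≡ ys
Increasing-↭⇒≡ inc inc′ p = Pointwise.Pointwise-≡⇒≡
  (↗↭↗⇒≋ ≤-totalOrder (Linked.map <⇒≤ inc) (Linked.map <⇒≤ inc′) (↭⇒↭ₛ p))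

Interleaving-Increasing : ∀ {xs ys zs} → Interleaving ys zs xs → Increasing xs →
                          Increasing ys × Increasing zs
Interleaving-Increasing []        inc = [] , []
Interleaving-Increasing (consˡ i) inc =
  let x< , inc′ = Increasing-∷⁻ inc
      incˡ , incʳ = Interleaving-Increasing i inc′
  in Increasing-∷⁺ (All.tabulate (All.lookup x< ∘ Interleaving-∈ʳ (Interleaving.swap i))) incˡ , incʳ
Interleaving-Increasing (consʳ i) inc =
  let x< , inc′ = Increasing-∷⁻ inc
      incˡ , incʳ = Interleaving-Increasing i inc′
  in incˡ , Increasing-∷⁺ (All.tabulate (All.lookup x< ∘ Interleaving-∈ʳ i)) incʳ

extract : ∀ {x : A} {xs} → x ∈ₗ xs → ∃ λ xs′ → xs ↭ x ∷ xs′
extract x∈ with ∈-∃++ x∈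
... | ys , zs , refl = ys ++ zs , shift _ ys zs

-- A partial converse of `toPermutation`: each entry of `xs` is taken from the side on which it is
-- found, which puts both sides into the order of `xs`.
interleave : ∀ {us vs} (xs : List A) → us ++ vs ↭ xs →
             ∃₂ λ ys zs → Interleaving ys zs xs × us ↭ ys × vs ↭ zs
interleave {us = []}     {[]} [] p = [] , [] , [] , ↭-refl , ↭-refl
interleave {us = []}     {_ ∷ _} [] p = case ↭-length p of λ ()
interleave {us = _ ∷ _}  [] p = case ↭-length p of λ ()
interleave {us = us} {vs} (x ∷ xs) p with ∈-++⁻ us (∈-resp-↭ (↭-sym p) (here refl))
... | inj₁ x∈us =
  let us′ , q = extract x∈us
      ys , zs , i , r , s = interleave xs (drop-∷ (↭-trans (↭-sym (++⁺ʳ vs q)) p))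
  in x ∷ ys , zs , consˡ i , ↭-trans q (prep x r) , s
... | inj₂ x∈vs =
  let vs′ , q = extract x∈vs
      ys , zs , i , r , s = interleave {us = us} xs
        (drop-∷ (↭-trans (↭-sym (↭-trans (++⁺ˡ us q) (shift x us vs′))) p))
  in ys , x ∷ zs , consʳ i , r , ↭-trans q (prep x s)

-- Both parts of an increasing list are increasing, hence determined by their entries. This is how a
-- split is recovered from the labels of a forest.
Interleaving-injective : ∀ {xs ys zs ys′ zs′} → Increasing xs →
  Interleaving ys zs xs → Interleaving ys′ zs′ xs →
  ys ↭ ys′ → zs ↭ zs′ → (ys , zs) ≡ (ys′ , zs′)
Interleaving-injective inc i i′ p q =
  let incˡ , incʳ = Interleaving-Increasing i inc
      incˡ′ , incʳ′ = Interleaving-Increasing i′ inc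
  in cong₂ _,_ (Increasing-↭⇒≡ incˡ incˡ′ p) (Increasing-↭⇒≡ incʳ incʳ′ q)

-- The `y` fibres of a map from `xs` to `y` colours. Fibres may be empty; increasing order makes
-- each list stand for a set.
Colouring : List ℕ → ℕ → Pred (List (List ℕ)) 0ℓ
Colouring xs y rs = length rs ≡ y × concat rs ↭ xs × All Increasing rs

-- Choosing the first colour class leaves a colouring with one colour fewer, and the sum over all
-- choices is the expansion of (1+y)^n.
HasSize-colourings : ∀ {xs} → Increasing xs → ∀ y → Colouring xs y HasSize (y ^ length xs)
HasSize-colourings {[]} inc zero = HasSize-singleton [] (refl , ↭-refl , [])
  λ { {[]} _ → refl }
HasSize-colourings {_ ∷ _} inc zero = HasSize-∅ λ { {[]} (_ , p , _) → case ↭-length p of λ () }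
HasSize-colourings {xs} inc (suc y) = subst (Colouring xs (suc y) HasSize_) size
  (HasSize-correspondence R total surjective
    (λ { _ _ _ refl refl → refl }) injective
    (HasSize-splits (Increasing⇒Unique inc)
      {λ _ zs → Colouring zs y} {λ _ j → y ^ j}
      (λ i → HasSize-colourings (proj₂ (Interleaving-Increasing i inc)) y)))
  where
  R : (List ℕ × List ℕ) × List (List ℕ) → List (List ℕ) → Set
  R ((ys , _) , rs) rs′ = rs′ ≡ ys ∷ rs

  total : ∀ {a} → Splits xs (λ _ zs → Colouring zs y) a → ∃ λ b → Colouring xs (suc y) b × R a b
  total {(ys , zs) , rs} (i , refl , p , incs) = ys ∷ rs ,
    (refl , ↭-trans (++⁺ˡ ys p) (↭-sym (toPermutation i)) ,
     proj₁ (Interleaving-Increasing i inc) ∷ incs) , refl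

  surjective : ∀ {b} → Colouring xs (suc y) b → ∃ λ a → Splits xs (λ _ zs → Colouring zs y) a × R a b
  surjective {r ∷ rs} (refl , p , incʳ ∷ incs) with interleave xs p
  ... | ys , zs , i , q , s
    with refl ← Increasing-↭⇒≡ incʳ (proj₁ (Interleaving-Increasing i inc)) q =
    ((r , zs) , rs) , (i , refl , s , incs) , refl

  injective : ∀ {a a′ b} → Splits xs (λ _ zs → Colouring zs y) a → Splits xs (λ _ zs → Colouring zs y) a′ →
              Colouring xs (suc y) b → R a b → R a′ b → a ≡ a′
  injective {(ys , _) , _} {(ys′ , _) , _} (i , _ , p , _) (i′ , _ , p′ , _) _ refl refl =
    cong (_, _) (Interleaving-injective inc i i′ ↭-refl (↭-trans (↭-sym p) p′))

  size : binomSum (length xs) (λ _ j → y ^ j) ≡ suc y ^ length xs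
  size = trans (binomSum-cong (length xs) λ i j _ → sym (trans (cong (_* y ^ j) (^-zeroˡ i)) (*-identityˡ _)))
               (binomial-theorem (length xs) 1 y)

-- Counting forests by removing their roots

children : PlaneTree A → Forest A
children (node _ cs) = cs

roots : Forest A → List A
roots = List.map root

Valid : Forest ℕ → Set
Valid ts = Increasing (roots ts) × All SiblingsIncrease ts

valid-children⁺ : ∀ {ts} → All SiblingsIncrease ts → All Valid (List.map children ts)
valid-children⁺ []              = []
valid-children⁺ (node i v ∷ vs) = (i , v) ∷ valid-children⁺ vs

valid-children⁻ : ∀ {ts} → All Valid (List.map children ts) → All SiblingsIncrease ts
valid-children⁻ {[]}          []             = []
valid-children⁻ {node _ _ ∷ _} ((i , v) ∷ vs) = node i v ∷ valid-children⁻ vs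

preorders : List (Forest A) → List A
preorders = concatMap preorder*

preorders-↭ : {hs hs′ : List (Forest ℕ)} → hs ↭ hs′ → preorders hs ↭ preorders hs′
preorders-↭ _↭_.refl          = ↭-refl
preorders-↭ (prep h p)        = ++⁺ˡ (preorder* h) (preorders-↭ p)
preorders-↭ (swap h h′ p)     =
  ↭-trans (++⁺ˡ (preorder* h) (++⁺ˡ (preorder* h′) (preorders-↭ p))) (shifts (preorder* h) (preorder* h′))
preorders-↭ (_↭_.trans p q)   = ↭-trans (preorders-↭ p) (preorders-↭ q)

preorder*-roots : (ts : Forest ℕ) → preorder* ts ↭ roots ts ++ preorders (List.map children ts)
preorder*-roots []               = ↭-refl
preorder*-roots (node x cs ∷ ts) = prep x (↭-trans
  (++⁺ˡ (preorder* cs) (preorder*-roots ts))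
  (shifts (preorder* cs) (roots ts)))

-- Flattening discards which forest a root came from, so that removing the roots turns a `y`-tuple
-- into a tuple indexed by roots; the lost information survives in `rootLists`.
grandchildren : List (Forest A) → List (Forest A)
grandchildren = concatMap (List.map children)

rootLists : List (Forest A) → List (List A)
rootLists = List.map roots

preorders-++ : (gs hs : List (Forest A)) → preorders (gs ++ hs) ≡ preorders gs ++ preorders hs
preorders-++ []       hs = refl
preorders-++ (g ∷ gs) hs = trans (cong (preorder* g ++_) (preorders-++ gs hs))
                                 (sym (++-assoc (preorder* g) (preorders gs) (preorders hs)))

preorders-levels : (gs : List (Forest ℕ)) →
                   preorders gs ↭ concat (rootLists gs) ++ preorders (grandchildren gs)
preorders-levels []       = ↭-refl
preorders-levels (g ∷ gs) = begin
  preorder* g ++ preorders gs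
    ↭⟨ ++⁺ (preorder*-roots g) (preorders-levels gs) ⟩
  (roots g ++ preorders gcs) ++ concat (rootLists gs) ++ preorders (grandchildren gs)
    ↭⟨ ++-solve 4 (λ a b c d → (a ⊕ b) ⊕ (c ⊕ d) ⊜ (a ⊕ c) ⊕ (b ⊕ d)) ↭-refl
         (roots g) (preorders gcs) (concat (rootLists gs)) (preorders (grandchildren gs)) ⟩
  concat (rootLists (g ∷ gs)) ++ preorders gcs ++ preorders (grandchildren gs)
    ≡⟨ cong (concat (rootLists (g ∷ gs)) ++_) (preorders-++ gcs (grandchildren gs)) ⟨
  concat (rootLists (g ∷ gs)) ++ preorders (grandchildren (g ∷ gs)) ∎
  where
  open PermutationReasoning
  gcs = List.map children g

plant : (xs : List A) (hs : List (Forest A)) → length hs ≡ length xs →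
        ∃ λ ts → roots ts ≡ xs × List.map children ts ≡ hs
plant []       []       refl = [] , refl , refl
plant (x ∷ xs) (h ∷ hs) eq with plant xs hs (suc-injective eq)
... | ts , refl , refl = node x h ∷ ts , refl , refl

plant-injective : {ts us : Forest A} → roots ts ≡ roots us →
                  List.map children ts ≡ List.map children us → ts ≡ us
plant-injective {ts = []}          {[]}          _ _ = refl
plant-injective {ts = node x h ∷ ts} {node y k ∷ us} r c
  with refl , r′ ← ∷-injective r | refl , c′ ← ∷-injective c =
  cong (node x h ∷_) (plant-injective r′ c′)

takeLength : (m : List B) (k : ℕ) (hs : List A) → length hs ≡ length m + k →
             ∃₂ λ gs gs′ → hs ≡ gs ++ gs′ × length gs ≡ length m × length gs′ ≡ k
takeLength []      k hs       eq = [] , hs , refl , refl , eq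
takeLength (_ ∷ m) k (h ∷ hs) eq with takeLength m k hs (suc-injective eq)
... | gs , gs′ , refl , eq₁ , eq₂ = h ∷ gs , gs′ , refl , cong suc eq₁ , eq₂

-- The lengths of the root lists tell where to cut the flattened list of child forests.
plants : (rs : List (List A)) (hs : List (Forest A)) → length hs ≡ length (concat rs) →
         ∃ λ gs → rootLists gs ≡ rs × grandchildren gs ≡ hs
plants []       []       refl = [] , refl , refl
plants (r ∷ rs) hs eq
  with takeLength r (length (concat rs)) hs (trans eq (length-++ r))
... | hs₁ , hs₂ , refl , eq₁ , eq₂
  with plant r hs₁ eq₁ | plants rs hs₂ eq₂
... | g , refl , refl | gs , refl , refl = g ∷ gs , refl , refl

++-injective : (us vs : List A) {us′ vs′ : List A} → length us ≡ length vs →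
               us ++ us′ ≡ vs ++ vs′ → us ≡ vs × us′ ≡ vs′
++-injective []       []       _  eq = refl , eq
++-injective (u ∷ us) (v ∷ vs) l≡ eq with ∷-injective eq
... | refl , eq′ with ++-injective us vs (suc-injective l≡) eq′
... | refl , eq″ = refl , eq″

plants-injective : {gs gs′ : List (Forest A)} → rootLists gs ≡ rootLists gs′ →
                   grandchildren gs ≡ grandchildren gs′ → gs ≡ gs′
plants-injective {gs = []}     {[]}       _ _ = refl
plants-injective {gs = g ∷ gs} {g′ ∷ gs′} r c with ∷-injective r
... | rg , rgs with ++-injective (List.map children g) (List.map children g′) lengths c
  where
  lengths : length (List.map children g) ≡ length (List.map children g′)
  lengths = trans (length-map children g) (trans (sym (length-map root g))
    (trans (cong length rg) (trans (length-map root g′) (sym (length-map children g′)))))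
... | cg , cgs = cong₂ _∷_ (plant-injective rg cg) (plants-injective rgs cgs)

-- y forests on a common set of labels, equivalently a forest whose roots carry
-- one of y colours.
Tuple : List ℕ → ℕ → Pred (List (Forest ℕ)) 0ℓ
Tuple xs y gs = length gs ≡ y × preorders gs ↭ xs × All Valid gs

length-rootLists : (gs : List (Forest A)) → length (grandchildren gs) ≡ length (concat (rootLists gs))
length-rootLists []       = refl
length-rootLists (g ∷ gs) = begin
  length (List.map children g ++ grandchildren gs)  ≡⟨ length-++ (List.map children g) ⟩
  length (List.map children g) + length (grandchildren gs)
    ≡⟨ cong₂ _+_ (trans (length-map children g) (sym (length-map root g))) (length-rootLists gs) ⟩
  length (roots g) + length (concat (rootLists gs)) ≡⟨ length-++ (roots g) ⟨
  length (roots g ++ concat (rootLists gs)) ∎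
  where open ≡-Reasoning

valid-levels⁺ : ∀ {gs} → All Valid gs → All Increasing (rootLists gs) × All Valid (grandchildren gs)
valid-levels⁺ []             = [] , []
valid-levels⁺ ((i , v) ∷ vs) = let is , ws = valid-levels⁺ vs in i ∷ is , All.++⁺ (valid-children⁺ v) ws

valid-levels⁻ : ∀ {gs} → All Increasing (rootLists gs) → All Valid (grandchildren gs) → All Valid gs
valid-levels⁻ {[]}     []       []  = []
valid-levels⁻ {g ∷ gs} (i ∷ is) ws =
  (i , valid-children⁻ (All.++⁻ˡ (List.map children g) ws)) ∷
  valid-levels⁻ is (All.++⁻ʳ (List.map children g) ws)

-- The two levels of a `y`-tuple with root labels `ks`: each root is coloured by the forest it
-- belongs to, and the child forests of all roots form a tuple on `zs`.
Levels : ℕ → List ℕ → List ℕ → Pred (List (List ℕ) × List (Forest ℕ)) 0ℓ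
Levels y ks zs (rs , hs) = Colouring ks y rs × Tuple zs (length ks) hs

HasSize-levels : ∀ {xs y c} → Increasing xs → Splits xs (Levels y) HasSize c → Tuple xs y HasSize c
HasSize-levels {xs} {y} inc = HasSize-correspondence R total surjective
  (λ { _ _ _ (r , s) (r′ , s′) → plants-injective (trans r (sym r′)) (trans s (sym s′)) })
  injective
  where
  R : (List ℕ × List ℕ) × (List (List ℕ) × List (Forest ℕ)) → List (Forest ℕ) → Set
  R (_ , (rs , hs)) gs = rootLists gs ≡ rs × grandchildren gs ≡ hs

  total : ∀ {a} → Splits xs (Levels y) a → ∃ λ b → Tuple xs y b × R a b
  total {(ks , zs) , (rs , hs)} (i , (refl , p , incs) , (l , q , valid))
    with plants rs hs (trans l (sym (↭-length p)))
  ... | gs , refl , refl = gs ,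
    ( sym (length-map roots gs)
    , ↭-trans (preorders-levels gs) (↭-trans (++⁺ p q) (↭-sym (toPermutation i)))
    , valid-levels⁻ incs valid) , refl , refl

  surjective : ∀ {b} → Tuple xs y b → ∃ λ a → Splits xs (Levels y) a × R a b
  surjective {gs} (refl , p , valid) with interleave xs (↭-trans (↭-sym (preorders-levels gs)) p)
  ... | ks , zs , i , q , r = _ ,
    (i , (length-map roots gs , q , proj₁ (valid-levels⁺ valid)) ,
     trans (length-rootLists gs) (↭-length q) , r , proj₂ (valid-levels⁺ valid)) , refl , refl

  injective : ∀ {a a′ b} → Splits xs (Levels y) a → Splits xs (Levels y) a′ →
              Tuple xs y b → R a b → R a′ b → a ≡ a′
  injective (i , (_ , p , _) , (_ , q , _)) (i′ , (_ , p′ , _) , (_ , q′ , _)) _ (refl , refl) (refl , refl) =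
    cong (_, _) (Interleaving-injective inc i i′ (↭-trans (↭-sym p) p′) (↭-trans (↭-sym q) q′))

-- The bound `N` provides strong induction: if there are labels at all, some of them are roots, and
-- the child forests carry strictly fewer.
HasSize-tuples : ∀ N {xs} → length xs ≤ N → Increasing xs → ∀ y → Tuple xs y HasSize #forestTuples (length xs) y
HasSize-tuples _ {[]} _ inc y =
  HasSize-singleton (replicate y []) (length-replicate y , none y , valid y)
    λ { {gs} (refl , p , _) → all-empty gs (↭-empty-inv p) }
  where
  none : ∀ y → preorders (replicate y []) ↭ []
  none zero    = ↭-refl
  none (suc y) = none y
  valid : ∀ y → All Valid (replicate y [])
  valid zero    = []
  valid (suc y) = ([] , []) ∷ valid y
  all-empty : (gs : List (Forest ℕ)) → preorders gs ≡ [] → gs ≡ replicate (length gs) []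
  all-empty []        _  = refl
  all-empty ([] ∷ gs) eq = cong ([] ∷_) (all-empty gs eq)
  all-empty ((node _ _ ∷ _) ∷ _) ()
HasSize-tuples (suc N) {xs@(_ ∷ xs′)} (s≤s l≤N) inc y =
  subst (Tuple xs y HasSize_) (binomSum-#forestTuples (length xs′) y)
    (HasSize-levels inc (HasSize-splits (Increasing⇒Unique inc)
      {g = λ k r → y ^ k * #forestTuples r k} sizes))
  where
  sizes : ∀ {ks zs} → Interleaving ks zs xs →
          Levels y ks zs HasSize (y ^ length ks * #forestTuples (length zs) (length ks))
  -- Without roots no child forest can carry the nonempty `zs`; the factor y = 0 in `#forestTuples`
  -- agrees.
  sizes {[]} {_ ∷ _} i = HasSize-∅ λ { {_ , []} (_ , _ , p , _) → case ↭-length p of λ () }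
  sizes {ks@(_ ∷ ks′)} {zs} i =
    let incˡ , incʳ = Interleaving-Increasing i inc
    in HasSize-× (HasSize-colourings incˡ y) λ _ → HasSize-tuples N smaller incʳ (length ks)
    where
    smaller : length zs ≤ N
    smaller = ≤-trans (≤-trans (m≤n+m _ (length ks′)) (≤-reflexive (suc-injective
      (trans (sym (length-++ ks)) (sym (↭-length (toPermutation i))))))) l≤N

-- A forest with roots ks and labels ks ++ zs, given by the child forests of all
-- its roots but one. The child forest of that root, the first or the last one,
-- is the next piece of the arm.
Family : List ℕ → List ℕ → Pred (List (Forest ℕ)) 0ℓ
Family []       zs gs = ⊥
Family (_ ∷ ks) zs gs = Tuple zs (length ks) gs

HasSize-arms : ∀ {xs} → Increasing xs → Splits xs Family HasSize #arms (length xs)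
HasSize-arms {xs} inc = subst (Splits xs Family HasSize_) (binomSum-families (length xs))
  (HasSize-splits (Increasing⇒Unique inc) sizes)
  where
  sizes : ∀ {ks zs} → Interleaving ks zs xs → Family ks zs HasSize families (length ks) (length zs)
  sizes {[]}     i = HasSize-∅ λ ()
  sizes {_ ∷ ks} i = HasSize-tuples _ ≤-refl (proj₂ (Interleaving-Increasing i inc)) (length ks)

-- Counting forests by the length of an arm

-- Equals n! times the coefficient of xⁿ in the k-th power of Σ (m-1)^(m-1) xᵐ/m!.
#byArmLength : ℕ → ℕ → ℕ
#byArmLength n       (suc k) = binomSum n (λ i j → #arms i * #byArmLength j k)
#byArmLength zero    zero    = 1
#byArmLength (suc _) zero    = 0

-- arm is the length of the path that starts at the root of the plane tree and
-- always continues to the first child, or always to the last one; insert puts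
-- the child forest on the path among the other child forests of a family.
module ArmLength
  (insert : Forest ℕ → List (Forest ℕ) → List (Forest ℕ))
  (insert-↭ : ∀ {cs gs} → insert cs gs ↭ cs ∷ gs)
  (insert-surjective : ∀ h hs → ∃₂ λ cs gs → h ∷ hs ≡ insert cs gs)
  (insert-injective : ∀ {cs gs cs′ gs′} → insert cs gs ≡ insert cs′ gs′ → cs ≡ cs′ × gs ≡ gs′)
  (arm : Forest ℕ → ℕ)
  (arm-[] : arm [] ≡ 0)
  (arm-insert : ∀ {cs gs} ts → List.map children ts ≡ insert cs gs → arm ts ≡ suc (arm cs))
  where

  ByArmLength : List ℕ → ℕ → Pred (Forest ℕ) 0ℓ
  ByArmLength xs k ts = (preorder* ts ↭ xs × Valid ts) × arm ts ≡ k

  -- `ys` holds the roots and everything below the roots off the arm; `zs` holds the forest `cs`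
  -- below the first node of the arm, in which the arm has `k` more edges.
  TopArm : ℕ → List ℕ → List ℕ → Pred (((List ℕ × List ℕ) × List (Forest ℕ)) × Forest ℕ) 0ℓ
  TopArm k ys zs (a , cs) = Splits ys Family a × ByArmLength zs k cs

  preorder*-insert : ∀ ts {cs gs} → List.map children ts ≡ insert cs gs →
                     preorder* ts ↭ (roots ts ++ preorders gs) ++ preorder* cs
  preorder*-insert ts {cs} {gs} eq = begin
    preorder* ts                                 ↭⟨ preorder*-roots ts ⟩
    roots ts ++ preorders (List.map children ts) ≡⟨ cong (λ hs → roots ts ++ preorders hs) eq ⟩
    roots ts ++ preorders (insert cs gs)         ↭⟨ ++⁺ˡ (roots ts) (preorders-↭ insert-↭) ⟩
    roots ts ++ preorder* cs ++ preorders gs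
      ↭⟨ ++-solve 3 (λ a b c → a ⊕ (b ⊕ c) ⊜ (a ⊕ c) ⊕ b) ↭-refl (roots ts) (preorder* cs) (preorders gs) ⟩
    (roots ts ++ preorders gs) ++ preorder* cs   ∎
    where open PermutationReasoning

  decompose : ∀ {xs k c} → Increasing xs → Splits xs (TopArm k) HasSize c →
              ByArmLength xs (suc k) HasSize c
  decompose {xs} {k} inc = HasSize-correspondence R total surjective
    (λ { _ _ _ (r , s) (r′ , s′) → plant-injective (trans r (sym r′)) (trans s (sym s′)) })
    injective
    where
    R : (List ℕ × List ℕ) × (((List ℕ × List ℕ) × List (Forest ℕ)) × Forest ℕ) → Forest ℕ → Set
    R (_ , (((ks , _) , gs) , cs)) ts = roots ts ≡ ks × List.map children ts ≡ insert cs gs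

    total : ∀ {a} → Splits xs (TopArm k) a → ∃ λ b → ByArmLength xs (suc k) b × R a b
    total {(ys , zs) , (((ks@(_ ∷ _) , ws) , gs) , cs)} (i , (j , (l , p , valid)) , ((q , validᶜ) , refl))
      with plant ks (insert cs gs) (trans (↭-length insert-↭) (cong suc l))
    ... | ts@(_ ∷ _) , refl , eq = ts ,
      ( ( ↭-trans (preorder*-insert ts eq) (↭-trans
            (++⁺ (↭-trans (++⁺ˡ (roots ts) p) (↭-sym (toPermutation j))) q)
            (↭-sym (toPermutation i)))
        , proj₁ (Interleaving-Increasing j (proj₁ (Interleaving-Increasing i inc)))
        , valid-children⁻ (subst (All Valid) (sym eq) (All-resp-↭ (↭-sym insert-↭) (validᶜ ∷ valid))))
      , arm-insert ts eq ) , refl , eq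

    surjective : ∀ {b} → ByArmLength xs (suc k) b → ∃ λ a → Splits xs (TopArm k) a × R a b
    surjective {[]} (_ , eq) = case trans (sym arm-[]) eq of λ ()
    surjective {ts@(t ∷ us)} ((p , inc′ , valid) , eq)
      with insert-surjective (children t) (List.map children us)
    ... | cs , gs , eq′
      with interleave xs (↭-trans (↭-sym (preorder*-insert ts eq′)) p)
    ... | ys , zs , i , q , r
      with interleave ys q
    ... | ks , ws , j , q′ , s
      -- The interleaving yields the root labels only up to order; both lists are increasing, so
      -- they coincide.
      with refl ← Increasing-↭⇒≡ inc′ (proj₁ (Interleaving-Increasing j (proj₁ (Interleaving-Increasing i inc)))) q′
      with validᶜ ∷ validᵍ ← All-resp-↭ insert-↭ (subst (All Valid) eq′ (valid-children⁺ valid)) =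
      _ , (i , (j , length-gs , s , validᵍ) ,
           ((r , validᶜ) , suc-injective (trans (sym (arm-insert ts eq′)) eq))) , refl , eq′
      where
      length-gs : length gs ≡ length (roots us)
      length-gs = suc-injective (trans (sym (↭-length (insert-↭ {cs} {gs}))) (trans (cong length (sym eq′))
        (cong suc (trans (length-map children us) (sym (length-map root us))))))

    injective : ∀ {a a′ b} → Splits xs (TopArm k) a → Splits xs (TopArm k) a′ →
                ByArmLength xs (suc k) b → R a b → R a′ b → a ≡ a′
    injective {_ , (((_ ∷ _ , _) , _) , _)} {_ , (((_ ∷ _ , _) , _) , _)}
      (i , (j , (_ , p , _)) , ((q , _) , _)) (i′ , (j′ , (_ , p′ , _)) , ((q′ , _) , _)) _ (r , s) (r′ , s′)
      with refl ← trans (sym r) r′ | refl , refl ← insert-injective (trans (sym s) s′)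
      -- The labels of the roots, `gs` and `cs` fix the outer split, and those of `gs` then fix the
      -- inner one.
      with refl ← Interleaving-injective inc i i′
             (↭-trans (toPermutation j) (↭-trans (++⁺ˡ _ (↭-trans (↭-sym p) p′)) (↭-sym (toPermutation j′))))
             (↭-trans (↭-sym q) q′)
      with refl ← Interleaving-injective (proj₁ (Interleaving-Increasing i inc)) j j′ ↭-refl (↭-trans (↭-sym p) p′) = refl

  HasSize-byArmLength : ∀ k {xs} → Increasing xs → ByArmLength xs k HasSize #byArmLength (length xs) k
  HasSize-byArmLength zero {[]} inc =
    HasSize-singleton [] ((↭-refl , [] , []) , arm-[])
      λ { {[]} _ → refl ; {node _ _ ∷ _} ((p , _) , _) → case ↭-length p of λ () }
  HasSize-byArmLength zero {_ ∷ _} inc = HasSize-∅ λ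
    { {[]} ((p , _) , _) → case ↭-length p of λ ()
    ; {t ∷ ts} (_ , eq) → let _ , _ , eq′ = insert-surjective (children t) (List.map children ts)
                          in case trans (sym (arm-insert (t ∷ ts) eq′)) eq of λ () }
  HasSize-byArmLength (suc k) {xs} inc = 
    decompose inc (HasSize-splits (Increasing⇒Unique inc)
      {g = λ i j → #arms i * #byArmLength j k}
      λ i → let incˡ , incʳ = Interleaving-Increasing i inc in
        HasSize-× (HasSize-arms incˡ) (λ _ → HasSize-byArmLength k incʳ))

  HasSize-LT : ∀ n k → (λ T → T ∈ LT n × arm (children T) ≡ k) HasSize #byArmLength n k
  HasSize-LT n k = subst ((λ T → T ∈ LT n × arm (children T) ≡ k) HasSize_)
    (cong (λ l → #byArmLength l k) (trans (length-map suc (upTo n)) (length-upTo n)))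
    (HasSize-cong
      (λ { (ts , ((p , inc , valid) , eq) , refl) →
           mkLT refl (subst (0 ∷ preorder* ts ↭_) (cong (0 ∷_) (map-upTo suc n)) (prep 0 p)) (node inc valid) , eq })
      (λ { {node _ ts} (mkLT refl p (node inc valid) , eq) →
           ts , ((drop-∷ (subst (0 ∷ preorder* ts ↭_) (cong (0 ∷_) (sym (map-upTo suc n))) p) , inc , valid) , eq) , refl })
      (HasSize-image (node 0) (λ { refl → refl }) (HasSize-byArmLength k increasing)))
    where
    increasing : Increasing (List.map suc (upTo n))
    increasing = subst Increasing (sym (map-upTo suc n)) (Linked.applyUpTo⁺₁ suc n (λ _ → ≤-refl))

rarm-root : ∀ x y (ts : Forest A) → rarm (node x ts) ≡ rarm (node y ts)
rarm-root x y []       = refl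
rarm-root x y (_ ∷ _) = refl

rarmLast-children : ∀ t (ts : Forest ℕ) gs {cs} → List.map children (t ∷ ts) ≡ gs ∷ʳ cs →
                    rarmLast t ts ≡ rarm (node 0 cs)
rarmLast-children (node x cs) []       []       refl = rarm-root x 0 cs
rarmLast-children t           (u ∷ us) (_ ∷ gs) eq   = rarmLast-children u us gs (∷-injectiveʳ eq)
rarmLast-children t           []       (_ ∷ []) ()
rarmLast-children t           []       (_ ∷ _ ∷ _) ()

larm-cons : ∀ {cs gs} ts → List.map children ts ≡ cs ∷ gs → larm (node 0 ts) ≡ suc (larm (node 0 cs))
larm-cons (node _ []      ∷ _) refl = refl
larm-cons (node _ (_ ∷ _) ∷ _) refl = refl

rarm-snoc : ∀ {cs gs} ts → List.map children ts ≡ gs ∷ʳ cs → rarm (node 0 ts) ≡ suc (rarm (node 0 cs))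
rarm-snoc {gs = []}    []       ()
rarm-snoc {gs = _ ∷ _} []       ()
rarm-snoc {gs = gs}    (t ∷ ts) eq = cong suc (rarmLast-children t ts gs eq)

∷-surjective : ∀ (x : A) (xs : List A) → ∃₂ λ (y : A) (ys : List A) → x ∷ xs ≡ y ∷ ys
∷-surjective x xs = x , xs , refl

∷ʳ-surjective : ∀ (x : A) xs → ∃₂ λ y ys → x ∷ xs ≡ ys ∷ʳ y
∷ʳ-surjective x []       = x , [] , refl
∷ʳ-surjective x (y ∷ xs) with ∷ʳ-surjective y xs
... | z , zs , eq = z , x ∷ zs , cong (x ∷_) eq

∷ʳ-injective-swapped : ∀ {x y : A} {xs ys} → xs ∷ʳ x ≡ ys ∷ʳ y → x ≡ y × xs ≡ ys
∷ʳ-injective-swapped {xs = xs} {ys} eq = let xs≡ys , x≡y = ∷ʳ-injective xs ys eq in x≡y , xs≡ys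

∷ʳ↭∷ : ∀ {x : A} {xs} → xs ∷ʳ x ↭ x ∷ xs
∷ʳ↭∷ {x = x} {xs} = ↭-sym (∷↭∷ʳ x xs)

module Larm = ArmLength _∷_ ↭-refl ∷-surjective ∷-injective (larm ∘ node 0) refl larm-cons

module Rarm = ArmLength (λ cs gs → gs ∷ʳ cs) ∷ʳ↭∷ ∷ʳ-surjective ∷ʳ-injective-swapped
  (rarm ∘ node 0) refl rarm-snoc

-- Exponential generating functions

fromℚᵘ-+ : ∀ p q → fromℚᵘ p ℚ.+ fromℚᵘ q ≡ fromℚᵘ (p ℚᵘ.+ q)
fromℚᵘ-+ p q = ℚ.toℚᵘ-injective (ℚᵘ.≃-trans (ℚ.toℚᵘ-homo-+ (fromℚᵘ p) (fromℚᵘ q))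
  (ℚᵘ.≃-trans (ℚᵘ.+-cong (ℚ.toℚᵘ-fromℚᵘ p) (ℚ.toℚᵘ-fromℚᵘ q)) (ℚᵘ.≃-sym (ℚ.toℚᵘ-fromℚᵘ (p ℚᵘ.+ q)))))

fromℚᵘ-* : ∀ p q → fromℚᵘ p ℚ.* fromℚᵘ q ≡ fromℚᵘ (p ℚᵘ.* q)
fromℚᵘ-* p q = ℚ.toℚᵘ-injective (ℚᵘ.≃-trans (ℚ.toℚᵘ-homo-* (fromℚᵘ p) (fromℚᵘ q))
  (ℚᵘ.≃-trans (ℚᵘ.*-cong (ℚ.toℚᵘ-fromℚᵘ p) (ℚ.toℚᵘ-fromℚᵘ q)) (ℚᵘ.≃-sym (ℚ.toℚᵘ-fromℚᵘ (p ℚᵘ.* q)))))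

fromℕ : ℕ → ℚ
fromℕ n = (ℤ.+ n) ℚ./ 1

fromℕ-+ : ∀ m n → fromℕ (m + n) ≡ fromℕ m ℚ.+ fromℕ n
fromℕ-+ m n = sym (trans (fromℚᵘ-+ (mkℚᵘ (ℤ.+ m) 0) (mkℚᵘ (ℤ.+ n) 0))
  (ℚ.fromℚᵘ-cong {mkℚᵘ (ℤ.+ m) 0 ℚᵘ.+ mkℚᵘ (ℤ.+ n) 0} {mkℚᵘ (ℤ.+ (m + n)) 0}
    (*≡* (identity (ℤ.+ m) (ℤ.+ n)))))
  where
  identity : ∀ a b → (a ℤ.* ℤ.+ 1 ℤ.+ b ℤ.* ℤ.+ 1) ℤ.* ℤ.+ 1 ≡ (a ℤ.+ b) ℤ.* ℤ.+ 1
  identity = solve-∀ᶻ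

fromℕ-* : ∀ m n → fromℕ (m * n) ≡ fromℕ m ℚ.* fromℕ n
fromℕ-* m n = sym (trans (fromℚᵘ-* (mkℚᵘ (ℤ.+ m) 0) (mkℚᵘ (ℤ.+ n) 0))
  (ℚ.fromℚᵘ-cong {mkℚᵘ (ℤ.+ m) 0 ℚᵘ.* mkℚᵘ (ℤ.+ n) 0} {mkℚᵘ (ℤ.+ (m * n)) 0}
    (*≡* (cong (ℤ._* ℤ.+ 1) (sym (ℤ.pos-* m n))))))

*-1/ : ∀ n d .{{_ : NonZero n}} .{{_ : NonZero d}} .{{_ : NonZero (n * d)}} →
       fromℕ n ℚ.* ((ℤ.+ 1) ℚ./ (n * d)) ≡ (ℤ.+ 1) ℚ./ d
*-1/ n@(suc _) d@(suc d-1) = trans (fromℚᵘ-* (mkℚᵘ (ℤ.+ n) 0) (mkℚᵘ (ℤ.+ 1) (pred (n * d))))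
  (ℚ.fromℚᵘ-cong {mkℚᵘ (ℤ.+ n) 0 ℚᵘ.* mkℚᵘ (ℤ.+ 1) (pred (n * d))} {mkℚᵘ (ℤ.+ 1) d-1}
    (*≡* (trans (identity (ℤ.+ n) (ℤ.+ d))
      (cong (λ z → ℤ.+ 1 ℤ.* (ℤ.+ 1 ℤ.* z)) (sym (ℤ.pos-* n d))))))
  where
  identity : ∀ a b → a ℤ.* ℤ.+ 1 ℤ.* b ≡ ℤ.+ 1 ℤ.* (ℤ.+ 1 ℤ.* (a ℤ.* b))
  identity = solve-∀ᶻ

1/! : ℕ → ℚ
1/! n = ((ℤ.+ 1) ℚ./ n !) {{n !≢0}}

suc*1/! : ∀ n → fromℕ (suc n) ℚ.* 1/! (suc n) ≡ 1/! n
suc*1/! n = *-1/ (suc n) (n !) {{_}} {{n !≢0}} {{suc n !≢0}}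

egf : (ℕ → ℕ) → ℕ → ℚ
egf f n = fromℕ (f n) /! n

-- Differentiating an exponential generating function shifts its sequence.
suc*egf : ∀ f n → fromℕ (suc n) ℚ.* egf f (suc n) ≡ egf (f ∘ suc) n
suc*egf f n = trans (exchange (fromℕ (suc n)) (fromℕ (f (suc n))) (1/! (suc n)))
                    (cong (fromℕ (f (suc n)) ℚ.*_) (suc*1/! n))
  where
  open ℚ-Solver
  exchange : ∀ a b c → a ℚ.* (b ℚ.* c) ≡ b ℚ.* (a ℚ.* c)
  exchange = solve 3 (λ a b c → a :* (b :* c) := b :* (a :* c)) refl

convolve : (ℕ → ℚ) → (ℕ → ℚ) → ℕ → ℚ
convolve u v n = ∑[ i ≤ n ] (u (toℕ i) ℚ.* v (n ∸ toℕ i))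

convolve-cong : ∀ {u u′ v v′} → u ≗ u′ → v ≗ v′ → ∀ n → convolve u v n ≡ convolve u′ v′ n
convolve-cong u≗ v≗ n = sum-cong-≗ {suc n} λ i → cong₂ ℚ._*_ (u≗ (toℕ i)) (v≗ (n ∸ toℕ i))

-- x d/dx
θ : (ℕ → ℚ) → ℕ → ℚ
θ u n = fromℕ n ℚ.* u n

convolve-zeroˡ : ∀ u v n → u 0 ≡ 0ℚ → convolve u v (suc n) ≡ convolve (u ∘ suc) v n
convolve-zeroˡ u v n u0≡0 = trans (cong (λ z → z ℚ.* v (suc n) ℚ.+ convolve (u ∘ suc) v n) u0≡0)
  (trans (cong (ℚ._+ convolve (u ∘ suc) v n) (ℚ.*-zeroˡ (v (suc n)))) (ℚ.+-identityˡ _))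

convolve-zeroʳ : ∀ u v n → v 0 ≡ 0ℚ → convolve u v (suc n) ≡ convolve u (v ∘ suc) n
convolve-zeroʳ u v zero    v0≡0 = cong (u 0 ℚ.* v 1 ℚ.+_)
  (trans (ℚ.+-identityʳ _) (trans (cong (u 1 ℚ.*_) v0≡0) (ℚ.*-zeroʳ (u 1))))
convolve-zeroʳ u v (suc n) v0≡0 = cong (u 0 ℚ.* v (suc (suc n)) ℚ.+_) (convolve-zeroʳ (u ∘ suc) v n v0≡0)

-- The Leibniz rule: in each term of the convolution n is split as i + (n - i).
θ-convolve : ∀ u v n → fromℕ n ℚ.* convolve u v n ≡ convolve (θ u) v n ℚ.+ convolve u (θ v) n
θ-convolve u v n = begin
  fromℕ n ℚ.* convolve u v n
    ≡⟨ *-distribˡ-sum {suc n} (fromℕ n) (λ i → u (toℕ i) ℚ.* v (n ∸ toℕ i)) ⟩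
  ∑[ i ≤ n ] (fromℕ n ℚ.* (u (toℕ i) ℚ.* v (n ∸ toℕ i)))
    ≡⟨ sum-cong-≗ {suc n} (λ i → trans
         (cong (ℚ._* (u (toℕ i) ℚ.* v (n ∸ toℕ i)))
           (trans (cong fromℕ (sym (m+[n∸m]≡n (toℕ≤pred[n] i)))) (fromℕ-+ (toℕ i) (n ∸ toℕ i))))
         (leibniz (fromℕ (toℕ i)) (fromℕ (n ∸ toℕ i)) (u (toℕ i)) (v (n ∸ toℕ i)))) ⟩
  ∑[ i ≤ n ] (θ u (toℕ i) ℚ.* v (n ∸ toℕ i) ℚ.+ u (toℕ i) ℚ.* θ v (n ∸ toℕ i))
    ≡⟨ ∑-distrib-+ {suc n} (λ i → θ u (toℕ i) ℚ.* v (n ∸ toℕ i)) (λ i → u (toℕ i) ℚ.* θ v (n ∸ toℕ i)) ⟩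
  convolve (θ u) v n ℚ.+ convolve u (θ v) n ∎
  where
  open ≡-Reasoning
  open ℚ-Solver
  leibniz : ∀ a b c d → (a ℚ.+ b) ℚ.* (c ℚ.* d) ≡ a ℚ.* c ℚ.* d ℚ.+ c ℚ.* (b ℚ.* d)
  leibniz = solve 4 (λ a b c d → (a :+ b) :* (c :* d) := a :* c :* d :+ c :* (b :* d)) refl

*-cancelˡ-fromℕ : ∀ n {p q} → fromℕ (suc n) ℚ.* p ≡ fromℕ (suc n) ℚ.* q → p ≡ q
*-cancelˡ-fromℕ n {p} {q} eq = trans (sym (recover p)) (trans (cong (r ℚ.*_) eq) (recover q))
  where
  r = (ℤ.+ 1) ℚ./ suc n
  unit : r ℚ.* fromℕ (suc n) ≡ 1ℚ
  unit = trans (ℚ.*-comm r (fromℕ (suc n)))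
    (trans (cong (fromℕ (suc n) ℚ.*_) (ℚ./-cong {ℤ.+ 1} {suc n} refl (sym (*-identityʳ (suc n)))))
           (*-1/ (suc n) 1))
  recover : ∀ p → r ℚ.* (fromℕ (suc n) ℚ.* p) ≡ p
  recover p = trans (sym (ℚ.*-assoc r _ p)) (trans (cong (ℚ._* p) unit) (ℚ.*-identityˡ p))

-- Pascal's rule in `binomSum` is the product rule (fg)' = f'g + fg'. Multiplication by n + 1, that
-- is `θ`, turns it into the Leibniz rule for the convolution, so no formula for binomial
-- coefficients enters.
egf-binomSum : ∀ n f g → egf (λ n → binomSum n (λ i j → f i * g j)) n ≡ convolve (egf f) (egf g) n
egf-binomSum zero f g = trans (cong (ℚ._* 1ℚ) (fromℕ-* (f 0) (g 0))) (identity (fromℕ (f 0)) (fromℕ (g 0)))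
  where
  open ℚ-Solver
  identity : ∀ a b → a ℚ.* b ℚ.* 1ℚ ≡ (a ℚ.* 1ℚ) ℚ.* (b ℚ.* 1ℚ) ℚ.+ 0ℚ
  identity = solve 2 (λ a b → a :* b :* con 1ℚ := (a :* con 1ℚ) :* (b :* con 1ℚ) :+ con 0ℚ) refl
egf-binomSum (suc n) f g = *-cancelˡ-fromℕ n (begin
  fromℕ (suc n) ℚ.* egf (λ n → binomSum n (λ i j → f i * g j)) (suc n)
    ≡⟨ suc*egf (λ n → binomSum n (λ i j → f i * g j)) n ⟩
  fromℕ (a + b) /! n
    ≡⟨ cong (_/! n) (fromℕ-+ a b) ⟩
  (fromℕ a ℚ.+ fromℕ b) /! n
    ≡⟨ ℚ.*-distribʳ-+ (1/! n) (fromℕ a) (fromℕ b) ⟩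
  fromℕ a /! n ℚ.+ fromℕ b /! n
    ≡⟨ cong₂ ℚ._+_ (egf-binomSum n (f ∘ suc) g) (egf-binomSum n f (g ∘ suc)) ⟩
  convolve (egf (f ∘ suc)) (egf g) n ℚ.+ convolve (egf f) (egf (g ∘ suc)) n
    ≡⟨ cong₂ ℚ._+_ 
         (convolve-cong {v = egf g} (suc*egf f) (λ _ → refl) n)
         (convolve-cong {egf f} {v = θ (egf g) ∘ suc} (λ _ → refl) (suc*egf g) n) ⟨
  convolve (θ (egf f) ∘ suc) (egf g) n ℚ.+ convolve (egf f) (θ (egf g) ∘ suc) n
    ≡⟨ cong₂ ℚ._+_ (convolve-zeroˡ (θ (egf f)) (egf g) n (ℚ.*-zeroˡ (egf f 0)))
                   (convolve-zeroʳ (egf f) (θ (egf g)) n (ℚ.*-zeroˡ (egf g 0))) ⟨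
  convolve (θ (egf f)) (egf g) (suc n) ℚ.+ convolve (egf f) (θ (egf g)) (suc n)
    ≡⟨ θ-convolve (egf f) (egf g) (suc n) ⟨
  fromℕ (suc n) ℚ.* convolve (egf f) (egf g) (suc n) ∎)
  where
  open ≡-Reasoning
  a = binomSum n (λ i j → f (suc i) * g j)
  b = binomSum n (λ i j → f i * g (suc j))

binomSum-flip : ∀ n f → binomSum n f ≡ binomSum n (λ i j → f j i)
binomSum-flip zero    f = refl
binomSum-flip (suc n) f = trans (+-comm (binomSum n (λ i j → f (suc i) j)) _)
  (cong₂ _+_ (binomSum-flip n (λ i j → f i (suc j))) (binomSum-flip n (λ i j → f (suc i) j)))

-- The recursion for the triangle

factor : Series
factor = 𝟙 ⊖ tA

factor-2+ : ∀ m l → factor m (suc (suc l)) ≡ 0ℚ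
factor-2+ zero    l = refl
factor-2+ (suc m) l = refl

factor-1 : ∀ m → factor m 1 ≡ ℚ.- egf #arms m
factor-1 zero    = refl
factor-1 (suc m) = ℚ.+-identityˡ _

-- Since `factor` is linear in t, only the last two terms survive.
factor-row : ∀ (u : ℕ → ℚ) m k → ∑[ j ≤ suc k ] (u (toℕ j) ℚ.* factor m (suc k ∸ toℕ j)) ≡
             u k ℚ.* factor m 1 ℚ.+ u (suc k) ℚ.* factor m 0
factor-row u m zero    = cong (u 0 ℚ.* factor m 1 ℚ.+_) (ℚ.+-identityʳ _)
factor-row u m (suc k) = trans
  (cong (ℚ._+ ∑[ j ≤ suc k ] (u (suc (toℕ j)) ℚ.* factor m (suc k ∸ toℕ j)))
    (trans (cong (u 0 ℚ.*_) (factor-2+ m k)) (ℚ.*-zeroʳ (u 0))))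
  (trans (ℚ.+-identityˡ _) (factor-row (u ∘ suc) m k))

-- The coefficient of t⁰ in `factor` is the series 1, the unit of convolution.
convolve-factor-0 : ∀ u n → convolve u (λ m → factor m 0) n ≡ u n
convolve-factor-0 u zero    = trans (ℚ.+-identityʳ _) (ℚ.*-identityʳ (u 0))
convolve-factor-0 u (suc n) = trans
  (cong (ℚ._+ convolve (u ∘ suc) (λ m → factor m 0) n) (ℚ.*-zeroʳ (u 0)))
  (trans (ℚ.+-identityˡ _) (convolve-factor-0 (u ∘ suc) n))

convolve-neg : ∀ u v n → convolve u (λ m → ℚ.- v m) n ≡ ℚ.- convolve u v n
convolve-neg u v zero    = identity (u 0) (v 0)
  where
  open ℚ-Solver
  identity : ∀ a b → a ℚ.* (ℚ.- b) ℚ.+ 0ℚ ≡ ℚ.- (a ℚ.* b ℚ.+ 0ℚ)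
  identity = solve 2 (λ a b → a :* (:- b) :+ con 0ℚ := :- (a :* b :+ con 0ℚ)) refl
convolve-neg u v (suc n) = trans (cong (u 0 ℚ.* (ℚ.- v (suc n)) ℚ.+_) (convolve-neg (u ∘ suc) v n))
  (identity (u 0) (v (suc n)) _)
  where
  open ℚ-Solver
  identity : ∀ a b c → a ℚ.* (ℚ.- b) ℚ.+ (ℚ.- c) ≡ ℚ.- (a ℚ.* b ℚ.+ c)
  identity = solve 3 (λ a b c → a :* (:- b) :+ (:- c) := :- (a :* b :+ c)) refl

⊛-factor : ∀ (f : Series) n k →
  (f ⊛ factor) n (suc k) ≡ ℚ.- convolve (λ i → f i k) (egf #arms) n ℚ.+ f n (suc k)
⊛-factor f n k = begin
  (f ⊛ factor) n (suc k)
    ≡⟨ sum-cong-≗ {suc n} (λ i → factor-row (f (toℕ i)) (n ∸ toℕ i) k) ⟩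
  ∑[ i ≤ n ] (f (toℕ i) k ℚ.* factor (n ∸ toℕ i) 1 ℚ.+ f (toℕ i) (suc k) ℚ.* factor (n ∸ toℕ i) 0)
    ≡⟨ ∑-distrib-+ {suc n} (λ i → f (toℕ i) k ℚ.* factor (n ∸ toℕ i) 1)
                           (λ i → f (toℕ i) (suc k) ℚ.* factor (n ∸ toℕ i) 0) ⟩
  convolve (λ i → f i k) (λ m → factor m 1) n ℚ.+ convolve (λ i → f i (suc k)) (λ m → factor m 0) n
    ≡⟨ cong₂ ℚ._+_
         (trans (convolve-cong {λ i → f i k} (λ _ → refl) factor-1 n)
                (convolve-neg (λ i → f i k) (egf #arms) n))
         (convolve-factor-0 (λ i → f i (suc k)) n) ⟩
  ℚ.- convolve (λ i → f i k) (egf #arms) n ℚ.+ f n (suc k) ∎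
  where open ≡-Reasoning

-- Write F for `genFun 𝒯` and A for the series of `#arms`. Comparing coefficients of t^(k+1) in F(1
-- - tA) = 1 gives F_(k+1) = F_k A, which is the recursion of `#byArmLength` with the factors
-- exchanged.
genFun≡egf : ∀ 𝒯 → IsTriangle 𝒯 → ∀ k n → genFun 𝒯 n k ≡ egf (λ n → #byArmLength n k) n
genFun≡egf 𝒯 isTriangle zero zero    = refl
genFun≡egf 𝒯 isTriangle zero (suc n) = sym (ℚ.*-zeroˡ (1/! (suc n)))
genFun≡egf 𝒯 isTriangle (suc k) n = begin
  genFun 𝒯 n (suc k)
    ≡⟨ solve-for (trans (sym (⊛-factor (genFun 𝒯) n k)) (trans (isTriangle n (suc k)) (𝟙-suc n))) ⟩
  convolve (λ i → genFun 𝒯 i k) (egf #arms) n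
    ≡⟨ convolve-cong {v = egf #arms} (genFun≡egf 𝒯 isTriangle k) (λ _ → refl) n ⟩
  convolve (egf (λ n → #byArmLength n k)) (egf #arms) n
    ≡⟨ egf-binomSum n (λ n → #byArmLength n k) #arms ⟨
  egf (λ n → binomSum n (λ i j → #byArmLength i k * #arms j)) n
    ≡⟨ cong (λ c → fromℕ c /! n) (trans (binomSum-flip n _) (binomSum-cong n λ i j _ → *-comm (#byArmLength j k) (#arms i))) ⟩
  egf (λ n → #byArmLength n (suc k)) n ∎
  where
  open ≡-Reasoning
  𝟙-suc : ∀ n → 𝟙 n (suc k) ≡ 0ℚ
  𝟙-suc zero    = refl
  𝟙-suc (suc n) = refl
  solve-for : ∀ {p q} → ℚ.- p ℚ.+ q ≡ 0ℚ → q ≡ p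
  solve-for {p} {q} eq = trans (identity p q) (trans (cong (p ℚ.+_) eq) (ℚ.+-identityʳ p))
    where
    open ℚ-Solver
    identity : ∀ p q → q ≡ p ℚ.+ (ℚ.- p ℚ.+ q)
    identity = solve 2 (λ p q → q := p :+ (:- p :+ q)) refl

*-/!-cancel : ∀ n {p q} → p /! n ≡ q /! n → p ≡ q
*-/!-cancel zero    {p} {q} eq = trans (sym (ℚ.*-identityʳ p)) (trans eq (ℚ.*-identityʳ q))
*-/!-cancel (suc n) {p} {q} eq = *-/!-cancel n (trans (sym (reduce p)) (trans (cong (fromℕ (suc n) ℚ.*_) eq) (reduce q)))
  where
  open ℚ-Solver
  exchange : ∀ a b c → a ℚ.* (b ℚ.* c) ≡ b ℚ.* (a ℚ.* c)
  exchange = solve 3 (λ a b c → a :* (b :* c) := b :* (a :* c)) refl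
  reduce : ∀ r → fromℕ (suc n) ℚ.* (r /! suc n) ≡ r /! n
  reduce r = trans (exchange (fromℕ (suc n)) r (1/! (suc n))) (cong (r ℚ.*_) (suc*1/! n))

triangle≡#byArmLength : ∀ 𝒯 → IsTriangle 𝒯 → ∀ n k → 1 ≤ k → k ≤ n → 𝒯 n k ≡ fromℕ (#byArmLength n k)
triangle≡#byArmLength 𝒯 isTriangle (suc n) (suc k) _ k≤n =
  *-/!-cancel (suc n) (trans (sym coefficient) (genFun≡egf 𝒯 isTriangle (suc k) (suc n)))
  where
  coefficient : genFun 𝒯 (suc n) (suc k) ≡ 𝒯 (suc n) (suc k) /! suc n
  coefficient with suc k ≤ᵇ suc n | ≤⇒≤ᵇ k≤n
  ... | true | _ = refl

-- The recursive structure of ϑ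

toList : BinTree A → List A
toList = Prefix.toList

toDiffList-++ : ∀ (t : BinTree A) ys → Prefix.toDiffList t ys ≡ toList t ++ ys
toDiffList-++ ∅            ys = refl
toDiffList-++ (node l x r) ys = cong (x ∷_) (begin
  Prefix.toDiffList l (Prefix.toDiffList r ys) ≡⟨ toDiffList-++ l _ ⟩
  toList l ++ Prefix.toDiffList r ys           ≡⟨ cong (toList l ++_) (toDiffList-++ r ys) ⟩
  toList l ++ toList r ++ ys                   ≡⟨ ++-assoc (toList l) _ ys ⟨
  (toList l ++ toList r) ++ ys                 ≡⟨ cong (_++ ys) (toDiffList-++ l _) ⟨
  Prefix.toDiffList l (toList r) ++ ys         ∎)
  where open ≡-Reasoning

toList-node : ∀ (l : BinTree A) x r → toList (node l x r) ≡ x ∷ toList l ++ toList r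
toList-node l x r = cong (x ∷_) (toDiffList-++ l (toList r))

-- Up to the relabeling, ϑ t is turn t ∅ ∅. The node of ϑ t inserted last is the
-- root of t; in turn t L R it carries the subtrees L and R.
turn : BinTree A → BinTree A → BinTree A → BinTree A
turn ∅                          L R = L
turn (node l x ∅)               L R = turn l (node L x R) ∅
turn (node l x r@(node _ _ _)) L R = turn r (turn l ∅ ∅) (node L x R)

-- Common form of `attachLeft` and `attachRight`, so that their passage through `turn` and through
-- contexts is proved once.
modify : ℕ → (BinTree ℕ → BinTree ℕ → BinTree ℕ) → BinTree ℕ → BinTree ℕ
modify p f ∅            = ∅
modify p f (node l x r) = if x ≡ᵇ p then f l r else node (modify p f l) x (modify p f r)

attachLeft≗modify : ∀ p v t → attachLeft p v t ≡ modify p (λ _ r → node (node ∅ v ∅) p r) t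
attachLeft≗modify p v ∅            = refl
attachLeft≗modify p v (node l x r) with x ≡ᵇ p in eq
... | true  = cong (λ y → node (node ∅ v ∅) y r) (≡ᵇ⇒≡ x p (subst T (sym eq) _))
... | false = cong₂ (λ l r → node l x r) (attachLeft≗modify p v l) (attachLeft≗modify p v r)

attachRight≗modify : ∀ p v t → attachRight p v t ≡ modify p (λ l _ → node l p (node ∅ v ∅)) t
attachRight≗modify p v ∅            = refl
attachRight≗modify p v (node l x r) with x ≡ᵇ p in eq
... | true  = cong (λ y → node l y (node ∅ v ∅)) (≡ᵇ⇒≡ x p (subst T (sym eq) _))
... | false = cong₂ (λ l r → node l x r) (attachRight≗modify p v l) (attachRight≗modify p v r)

≡ᵇ-refl : ∀ x → (x ≡ᵇ x) ≡ true
≡ᵇ-refl zero    = refl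
≡ᵇ-refl (suc x) = ≡ᵇ-refl x

≢⇒≡ᵇ-false : ∀ {x y} → x ≢ y → (x ≡ᵇ y) ≡ false
≢⇒≡ᵇ-false {x} {y} x≢y with x ≡ᵇ y in eq
... | false = refl
... | true  = contradiction (≡ᵇ⇒≡ x y (subst T (sym eq) _)) x≢y

modify-root : ∀ p f l r → modify p f (node l p r) ≡ f l r
modify-root p f l r rewrite ≡ᵇ-refl p = refl

modify-node : ∀ {p x} f l r → x ≢ p → modify p f (node l x r) ≡ node (modify p f l) x (modify p f r)
modify-node f l r x≢p rewrite ≢⇒≡ᵇ-false x≢p = refl

root∉ : ∀ {p x} (l r : BinTree ℕ) → p ∉ toList (node l x r) → x ≢ p
root∉ l r p∉ refl = p∉ (here refl)

∉-left : ∀ {p x : ℕ} (l : BinTree ℕ) r → p ∉ toList (node l x r) → p ∉ toList l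
∉-left {p} l r p∉ p∈ = p∉ (there (subst (p ∈ₗ_) (sym (toDiffList-++ l _)) (∈-++⁺ˡ p∈)))

∉-right : ∀ {p x : ℕ} (l : BinTree ℕ) r → p ∉ toList (node l x r) → p ∉ toList r
∉-right {p} l r p∉ p∈ = p∉ (there (subst (p ∈ₗ_) (sym (toDiffList-++ l _)) (∈-++⁺ʳ (toList l) p∈)))

-- `turn b` moves `L` and `R` around without inspecting them, and the node `p` can only occur inside
-- these two.
modify-turn : ∀ {p} f b L R → p ∉ toList b →
              modify p f (turn b L R) ≡ turn b (modify p f L) (modify p f R)
modify-turn f ∅ L R p∉ = refl
modify-turn f (node l x ∅) L R p∉ =
  trans (modify-turn f l (node L x R) ∅ (∉-left l ∅ p∉))
        (cong (λ t → turn l t ∅) (modify-node f L R (root∉ l ∅ p∉)))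
modify-turn f (node l x r@(node _ _ _)) L R p∉ =
  trans (modify-turn f r (turn l ∅ ∅) (node L x R) (∉-right l r p∉))
        (cong₂ (turn r) (modify-turn f l ∅ ∅ (∉-left l r p∉)) (modify-node f L R (root∉ l r p∉)))

Unique-++⁻ : ∀ (xs : List A) {ys} → Unique (xs ++ ys) →
             Unique xs × Unique ys × (∀ {z} → z ∈ₗ xs → z ∉ ys)
Unique-++⁻ []       u        = [] , u , λ ()
Unique-++⁻ (x ∷ xs) (x∉ ∷ u) =
  let u₁ , u₂ , dis = Unique-++⁻ xs u
  in All.++⁻ˡ xs x∉ ∷ u₁ , u₂ ,
     λ { (here refl) z∈ → All.lookup (All.++⁻ʳ xs x∉) z∈ refl ; (there z∈xs) → dis z∈xs }

record Distinct (l : BinTree ℕ) (x : ℕ) (r : BinTree ℕ) : Set where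
  constructor distinct
  field
    x∉l : x ∉ toList l
    x∉r : x ∉ toList r
    disjoint : ∀ {p} → p ∈ₗ toList l → p ∉ toList r
    uniqueˡ : Unique (toList l)
    uniqueʳ : Unique (toList r)

unique⇒distinct : ∀ l x r → Unique (toList (node l x r)) → Distinct l x r
unique⇒distinct l x r uniq with subst Unique (toList-node l x r) uniq
... | x∉ ∷ u = let uˡ , uʳ , dis = Unique-++⁻ (toList l) u in distinct
  (λ x∈ → All.lookup x∉ (∈-++⁺ˡ x∈) refl)
  (λ x∈ → All.lookup x∉ (∈-++⁺ʳ (toList l) x∈) refl)
  dis
  uˡ uʳ


-- The root `x` becomes the parent of `L` and `R`, so attaching a child to it only changes these two
-- arguments.
modify-turn-root : ∀ f l x r {L R L′ R′} → Unique (toList (node l x r)) → f L R ≡ node L′ x R′ →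
                   modify x f (turn (node l x r) L R) ≡ turn (node l x r) L′ R′
modify-turn-root f l x ∅ {L} {R} uniq eq =
  trans (modify-turn f l (node L x R) ∅ (Distinct.x∉l (unique⇒distinct l x ∅ uniq)))
        (cong (λ t → turn l t ∅) (trans (modify-root x f L R) eq))
modify-turn-root f l x r@(node _ _ _) {L} {R} uniq eq =
  let dist = unique⇒distinct l x r uniq in
  trans (modify-turn f r (turn l ∅ ∅) (node L x R) (Distinct.x∉r dist))
        (cong₂ (turn r) (modify-turn f l ∅ ∅ (Distinct.x∉l dist)) (trans (modify-root x f L R) eq))

rightChild-∉ : ∀ b {v} → v ∉ toList b → rightChild b v ≡ nothing
rightChild-∉ ∅            v∉ = refl
rightChild-∉ (node l x r) v∉
  rewrite ≢⇒≡ᵇ-false (root∉ l r v∉) | rightChild-∉ l (∉-left l r v∉) = rightChild-∉ r (∉-right l r v∉)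

rightChild-root : ∀ l x r → rightChild (node l x r) x ≡ root? r
rightChild-root l x r rewrite ≡ᵇ-refl x = refl

<∣>-identityʳ : ∀ (m : Maybe A) → (m <∣> nothing) ≡ m
<∣>-identityʳ (just _) = refl
<∣>-identityʳ nothing  = refl

rightChild-left : ∀ {l x r v} → Distinct l x r → v ∈ₗ toList l → rightChild (node l x r) v ≡ rightChild l v
rightChild-left {l} {x} {r} {v} dist v∈
  rewrite ≢⇒≡ᵇ-false {x} {v} (λ { refl → Distinct.x∉l dist v∈ })
        | rightChild-∉ r (Distinct.disjoint dist v∈) = <∣>-identityʳ (rightChild l v)

rightChild-right : ∀ {l x r v} → Distinct l x r → v ∈ₗ toList r → rightChild (node l x r) v ≡ rightChild r v
rightChild-right {l} {x} {r} {v} dist v∈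
  rewrite ≢⇒≡ᵇ-false {x} {v} (λ { refl → Distinct.x∉r dist v∈ })
        | rightChild-∉ l (λ v∈l → Distinct.disjoint dist v∈l v∈) = refl

-- A context of b is a partial tree with a hole at the place where the last
-- node of b is going to be attached.
CommutesOn : BinTree ℕ → (BinTree ℕ → BinTree ℕ) → Set
CommutesOn b C = ∀ {p} f t → p ∈ₗ toList b → modify p f (C t) ≡ C (modify p f t)

-- A node without right child goes to the left of its successor in preorder. That successor is the
-- root of `b`; if `b` is empty, the last hypothesis says that the node fills the hole of `C`.
build-attachLeft : ∀ B b rest C → Unique (toList b) → CommutesOn b C →
  build B (toList b ++ rest) ≡ C (turn b ∅ ∅) →
  (∀ {v} → rightChild B v ≡ nothing → build B (v ∷ rest) ≡ C (node ∅ v ∅)) →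
  ∀ {v} → rightChild B v ≡ nothing → build B (v ∷ toList b ++ rest) ≡ C (turn b (node ∅ v ∅) ∅)
build-attachLeft B ∅ rest C uniq commute built step = step
build-attachLeft B b@(node l z r) rest C uniq commute built step {v} none = begin
  insert B v z (build B (toList b ++ rest))
    ≡⟨ cong (maybe′ (λ u → attachRight u v t) (attachLeft z v t)) none ⟩
  attachLeft z v t
    ≡⟨ cong (attachLeft z v) built ⟩
  attachLeft z v (C (turn b ∅ ∅))
    ≡⟨ attachLeft≗modify z v (C (turn b ∅ ∅)) ⟩
  modify z _ (C (turn b ∅ ∅))
    ≡⟨ commute _ _ (here refl) ⟩
  C (modify z _ (turn b ∅ ∅))
    ≡⟨ cong C (modify-turn-root _ l z r uniq refl) ⟩
  C (turn b (node ∅ v ∅) ∅) ∎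
  where
  open ≡-Reasoning
  t = build B (toList b ++ rest)

build-attachRight : ∀ B l r rest C {z v} → Unique (toList r) → CommutesOn r C →
  root? r ≡ just z → rightChild B v ≡ just z →
  build B (toList l ++ toList r ++ rest) ≡ C (turn r (turn l ∅ ∅) ∅) →
  build B (v ∷ toList l ++ toList r ++ rest) ≡ C (turn r (turn l ∅ ∅) (node ∅ v ∅))
build-attachRight B l r@(node l₁ z r₁) rest C {v = v} uniq commute refl right built = begin
  build B (v ∷ toList l ++ toList r ++ rest)
    ≡⟨ insert-v l ⟩
  attachRight z v (build B (toList l ++ toList r ++ rest))
    ≡⟨ cong (attachRight z v) built ⟩
  attachRight z v (C (turn r (turn l ∅ ∅) ∅))
    ≡⟨ attachRight≗modify z v (C (turn r (turn l ∅ ∅) ∅)) ⟩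
  modify z _ (C (turn r (turn l ∅ ∅) ∅))
    ≡⟨ commute _ _ (here refl) ⟩
  C (modify z _ (turn r (turn l ∅ ∅) ∅))
    ≡⟨ cong C (modify-turn-root _ l₁ z r₁ uniq refl) ⟩
  C (turn r (turn l ∅ ∅) (node ∅ v ∅)) ∎
  where
  open ≡-Reasoning
  -- The cases only exhibit the successor of `v`, which `insert` ignores when `v` has a right child.
  insert-v : ∀ l → build B (v ∷ toList l ++ toList r ++ rest) ≡
                   attachRight z v (build B (toList l ++ toList r ++ rest))
  insert-v ∅            rewrite right = refl
  insert-v (node _ _ _) rewrite right = refl

build-attach : ∀ B l x r rest C → Unique (toList l) → Unique (toList r) →
  CommutesOn l C → CommutesOn r C → rightChild B x ≡ root? r →
  build B (toList l ++ toList r ++ rest) ≡ C (turn r (turn l ∅ ∅) ∅) →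
  (∀ {v} → rightChild B v ≡ nothing → build B (v ∷ rest) ≡ C (node ∅ v ∅)) →
  build B (x ∷ toList l ++ toList r ++ rest) ≡ C (turn (node l x r) ∅ ∅)
build-attach B l x ∅ rest C uˡ uʳ comˡ comʳ right built step =
  build-attachLeft B l rest C uˡ comˡ built step right
build-attach B l x r@(node _ _ _) rest C uˡ uʳ comˡ comʳ right built step =
  build-attachRight B l r rest C uʳ comʳ refl right built

-- The invariant of the insertion: `rest` has produced `C ∅`, and the next node without right child
-- would fill the hole. As `build` works from the end of the list, the right subtree comes before
-- the left one, and the root comes last.
build-++ : ∀ B b rest (C : BinTree ℕ → BinTree ℕ) → Unique (toList b) →
  (∀ {v} → v ∈ₗ toList b → rightChild B v ≡ rightChild b v) →
  CommutesOn b C →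
  build B rest ≡ C ∅ →
  (∀ {v} → rightChild B v ≡ nothing → build B (v ∷ rest) ≡ C (node ∅ v ∅)) →
  build B (toList b ++ rest) ≡ C (turn b ∅ ∅)
build-++ B ∅ rest C uniq same commute built step = built
build-++ B (node l x r) rest C uniq same commute built step =
  trans (cong (build B) list) (build-attach B l x r rest C (Distinct.uniqueˡ dist) (Distinct.uniqueʳ dist)
    (λ f t → commute f t ∘ ∈-l) (λ f t → commute f t ∘ ∈-r)
    (trans (same (here refl)) (rightChild-root l x r)) built-l step)
  where
  dist = unique⇒distinct l x r uniq
  list : toList (node l x r) ++ rest ≡ x ∷ toList l ++ toList r ++ rest
  list = trans (cong (_++ rest) (toList-node l x r)) (cong (x ∷_) (++-assoc (toList l) (toList r) rest))
  ∈-l : ∀ {v} → v ∈ₗ toList l → v ∈ₗ toList (node l x r)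
  ∈-l {v} v∈ = subst (v ∈ₗ_) (sym (toList-node l x r)) (there (∈-++⁺ˡ v∈))
  ∈-r : ∀ {v} → v ∈ₗ toList r → v ∈ₗ toList (node l x r)
  ∈-r {v} v∈ = subst (v ∈ₗ_) (sym (toList-node l x r)) (there (∈-++⁺ʳ (toList l) v∈))
  built-r : build B (toList r ++ rest) ≡ C (turn r ∅ ∅)
  built-r = build-++ B r rest C (Distinct.uniqueʳ dist)
    (λ v∈ → trans (same (∈-r v∈)) (rightChild-right dist v∈))
    (λ f t → commute f t ∘ ∈-r) built step
  -- After `r` the hole is the place of the left child at the root of `r`, or still the hole of `C`
  -- if `r` is empty.
  built-l : build B (toList l ++ toList r ++ rest) ≡ C (turn r (turn l ∅ ∅) ∅)
  built-l = build-++ B l (toList r ++ rest) (λ t → C (turn r t ∅)) (Distinct.uniqueˡ dist)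
    (λ v∈ → trans (same (∈-l v∈)) (rightChild-left dist v∈))
    (λ f t p∈ → trans (commute f (turn r t ∅) (∈-l p∈))
                      (cong C (modify-turn f r t ∅ (Distinct.disjoint dist p∈))))
    built-r
    (build-attachLeft B r rest C (Distinct.uniqueʳ dist) (λ f t → commute f t ∘ ∈-r) built-r step)

build≡turn : ∀ B → Unique (toList B) → build B (toList B) ≡ turn B ∅ ∅
build≡turn B uniq = trans (cong (build B) (sym (++-identityʳ (toList B))))
  (build-++ B B [] id uniq (λ _ → refl) (λ _ _ _ → refl) refl (λ _ → refl))

-- Turning twice

join : BinTree A → BinTree A → BinTree A → BinTree A
join L ∅              X = turn L X ∅
join L R@(node _ _ _) X = turn R (turn L ∅ ∅) X

turn-join : ∀ L (x : A) R P Q → turn (node L x R) P Q ≡ join L R (node P x Q)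
turn-join L x ∅            P Q = refl
turn-join L x (node _ _ _) P Q = refl

-- As in reversing a list with an accumulator, the second `turn` unrolls what the first one has
-- rolled onto `L` and `R`, and the original tree reappears as the argument of `join`.
turn-turn : ∀ (l : BinTree A) x r L R → turn (turn (node l x r) L R) ∅ ∅ ≡ join L R (node l x r)
turn-involutive : (t : BinTree A) → turn (turn t ∅ ∅) ∅ ∅ ≡ t
turn-turn ∅                 x ∅ L R = turn-join L x R ∅ ∅
turn-turn l@(node l₁ y r₁) x ∅ L R = trans (turn-turn l₁ y r₁ (node L x R) ∅) (turn-join L x R l ∅)
turn-turn l x r@(node l₁ y r₁) L R = begin
  turn (turn r (turn l ∅ ∅) (node L x R)) ∅ ∅
    ≡⟨ turn-turn l₁ y r₁ (turn l ∅ ∅) (node L x R) ⟩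
  turn (node L x R) (turn (turn l ∅ ∅) ∅ ∅) r
    -- A left subtree beside a right sibling was turned on its own; the mutual induction restores
    -- it.
    ≡⟨ cong (λ t → turn (node L x R) t r) (turn-involutive l) ⟩
  turn (node L x R) l r
    ≡⟨ turn-join L x R l r ⟩
  join L R (node l x r) ∎
  where open ≡-Reasoning
turn-involutive ∅            = refl
turn-involutive (node l x r) = turn-turn l x r ∅ ∅

mapₙ-turn : ∀ (f : A → B) t L R → mapₙ f (turn t L R) ≡ turn (mapₙ f t) (mapₙ f L) (mapₙ f R)
mapₙ-turn f ∅                         L R = refl
mapₙ-turn f (node l x ∅)              L R = mapₙ-turn f l (node L x R) ∅
mapₙ-turn f (node l x r@(node _ _ _)) L R = trans (mapₙ-turn f r (turn l ∅ ∅) (node L x R))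
  (cong (λ t → turn (mapₙ f r) t (node (mapₙ f L) (f x) (mapₙ f R))) (mapₙ-turn f l ∅ ∅))

-- Labels under ϑ

toList-mapₙ : ∀ (f : A → B) t → toList (mapₙ f t) ≡ List.map f (toList t)
toList-mapₙ f ∅            = refl
toList-mapₙ f (node l x r) = begin
  toList (mapₙ f (node l x r))                       ≡⟨ toList-node (mapₙ f l) (f x) (mapₙ f r) ⟩
  f x ∷ toList (mapₙ f l) ++ toList (mapₙ f r)
    ≡⟨ cong₂ (λ ys zs → f x ∷ ys ++ zs) (toList-mapₙ f l) (toList-mapₙ f r) ⟩
  f x ∷ List.map f (toList l) ++ List.map f (toList r) ≡⟨ cong (f x ∷_) (map-++ f (toList l) (toList r)) ⟨
  f x ∷ List.map f (toList l ++ toList r)             ≡⟨ cong (List.map f) (toList-node l x r) ⟨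
  List.map f (toList (node l x r))                   ∎
  where open ≡-Reasoning

length-toList : (t : BinTree A) → length (toList t) ≡ #nodes t
length-toList ∅            = refl
length-toList (node l x r) = begin
  length (toList (node l x r))               ≡⟨ cong length (toList-node l x r) ⟩
  suc (length (toList l ++ toList r))        ≡⟨ cong suc (length-++ (toList l)) ⟩
  suc (length (toList l) + length (toList r)) ≡⟨ cong suc (cong₂ _+_ (length-toList l) (length-toList r)) ⟩
  suc (#nodes l + #nodes r)                  ≡⟨ +-suc (#nodes l) (#nodes r) ⟨
  #nodes l + suc (#nodes r)                  ∎
  where open ≡-Reasoning

toList-turn-node : ∀ (l : BinTree ℕ) x r L R →
  toList (turn (node l x r) L R) ↭ toList (node l x r) ++ (toList L ++ toList R)
toList-turn : ∀ (t L : BinTree ℕ) → toList (turn t L ∅) ↭ toList t ++ toList L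
toList-turn ∅            L = ↭-refl
toList-turn (node l x r) L = ↭-trans (toList-turn-node l x r L ∅)
  (++⁺ˡ (toList (node l x r)) (↭-reflexive (++-identityʳ (toList L))))
toList-turn-node l x ∅ L R = begin
  toList (turn l (node L x R) ∅)         ↭⟨ toList-turn l (node L x R) ⟩
  toList l ++ toList (node L x R)        ≡⟨ cong (toList l ++_) (toList-node L x R) ⟩
  toList l ++ (x ∷ []) ++ (toList L ++ toList R)
    ↭⟨ ++-solve 4 (λ a b c d → a ⊕ (b ⊕ (c ⊕ d)) ⊜ (b ⊕ a) ⊕ (c ⊕ d)) ↭-refl (toList l) (x ∷ []) (toList L) (toList R) ⟩
  (x ∷ toList l) ++ (toList L ++ toList R)
    ≡⟨⟩
  toList (node l x ∅) ++ (toList L ++ toList R) ∎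
  where open PermutationReasoning
toList-turn-node l x r@(node l₁ y r₁) L R = begin
  toList (turn r (turn l ∅ ∅) (node L x R))
    ↭⟨ toList-turn-node l₁ y r₁ (turn l ∅ ∅) (node L x R) ⟩
  toList r ++ toList (turn l ∅ ∅) ++ toList (node L x R)
    ↭⟨ ++⁺ˡ (toList r) (++⁺ (toList-turn l ∅) (↭-reflexive (toList-node L x R))) ⟩
  toList r ++ (toList l ++ []) ++ (x ∷ []) ++ (toList L ++ toList R)
    ≡⟨ cong (λ ys → toList r ++ ys ++ (x ∷ []) ++ (toList L ++ toList R)) (++-identityʳ (toList l)) ⟩
  toList r ++ toList l ++ (x ∷ []) ++ (toList L ++ toList R)
    ↭⟨ ++-solve 4 (λ a b c d → a ⊕ (b ⊕ (c ⊕ d)) ⊜ (c ⊕ (b ⊕ a)) ⊕ d) ↭-refl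
         (toList r) (toList l) (x ∷ []) (toList L ++ toList R) ⟩
  (x ∷ toList l ++ toList r) ++ (toList L ++ toList R)
    ≡⟨ cong (_++ (toList L ++ toList R)) (toList-node l x r) ⟨
  toList (node l x r) ++ (toList L ++ toList R) ∎
  where open PermutationReasoning

toList-turn-∅ : (t : BinTree ℕ) → toList (turn t ∅ ∅) ↭ toList t
toList-turn-∅ t = ↭-trans (toList-turn t ∅) (↭-reflexive (++-identityʳ (toList t)))

-- The relation is a parameter because, between `turn` and the relabeling, right children are
-- smaller than their parents.
RightChildren : (ℕ → ℕ → Set) → BinTree ℕ → Set
RightChildren _~_ ∅            = ⊤
RightChildren _~_ (node l x r) = RightChildren _~_ l × MaybeAll.All (x ~_) (root? r) × RightChildren _~_ r

rightIncreasing⁻ : ∀ {t} → RightIncreasing t → RightChildren _<_ t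
rightIncreasing⁻ empty        = tt
rightIncreasing⁻ (node l p r) = rightIncreasing⁻ l , p , rightIncreasing⁻ r

rightIncreasing⁺ : ∀ {t} → RightChildren _<_ t → RightIncreasing t
rightIncreasing⁺ {∅}          tt          = empty
rightIncreasing⁺ {node _ _ _} (l , p , r) = node (rightIncreasing⁺ l) p (rightIncreasing⁺ r)

-- A right edge from `x` to `y` becomes a right edge from `y` to `x`; left edges carry no condition.
rightChildren-turn : ∀ t {L} → RightChildren _<_ t → RightChildren _>_ L → RightChildren _>_ (turn t L ∅)
rightChildren-turn-node : ∀ l x r {L R} → RightChildren _<_ (node l x r) →
  RightChildren _>_ (node L x R) → RightChildren _>_ (turn (node l x r) L R)
rightChildren-turn ∅            _   pL = pL
rightChildren-turn (node l x r) inc pL = rightChildren-turn-node l x r inc (pL , nothing , tt)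
rightChildren-turn-node l x ∅ (incˡ , _ , _) p = rightChildren-turn l incˡ p
rightChildren-turn-node l x (node l₁ y r₁) (incˡ , just x<y , incʳ) p =
  rightChildren-turn-node l₁ y r₁ incʳ (rightChildren-turn l incˡ tt , just x<y , p)

All-toList⁻ : ∀ (l : BinTree ℕ) x r {P : ℕ → Set} → All P (toList (node l x r)) →
              P x × All P (toList l) × All P (toList r)
All-toList⁻ l x r ps with subst (All _) (toList-node l x r) ps
... | p ∷ qs = p , All.++⁻ˡ (toList l) qs , All.++⁻ʳ (toList l) qs

-- Complementation reverses the order; truncated subtraction does so strictly only for labels up to
-- `n`.
rightChildren-complement : ∀ n t → All (_≤ n) (toList t) → RightChildren _>_ t →
                           RightChildren _<_ (mapₙ (n ∸_) t)
rightChildren-complement n ∅ _ tt = tt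
rightChildren-complement n (node l x r) ≤n (pl , p , pr) with All-toList⁻ l x r ≤n
... | x≤n , l≤n , r≤n =
  rightChildren-complement n l l≤n pl , root-child r p , rightChildren-complement n r r≤n pr
  where
  root-child : ∀ r → MaybeAll.All (x >_) (root? r) → MaybeAll.All ((n ∸ x) <_) (root? (mapₙ (n ∸_) r))
  root-child ∅            nothing    = nothing
  root-child (node _ _ _) (just x>y) = just (∸-monoʳ-< x>y x≤n)

mapₙ-id : ∀ {f : ℕ → ℕ} t → All (λ x → f x ≡ x) (toList t) → mapₙ f t ≡ t
mapₙ-id ∅            _  = refl
mapₙ-id (node l x r) ps with All-toList⁻ l x r ps
... | p , pl , pr rewrite p = cong₂ (λ l r → node l x r) (mapₙ-id l pl) (mapₙ-id r pr)

module _ {n} {t : BinTree ℕ} (rb : t ∈ RB n) where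
  open RB rb

  labels-unique : Unique (toList t)
  labels-unique = Unique-resp-↭ (↭⇒↭ₛ (↭-sym labels)) (Unique.map⁺ suc-injective (Unique.upTo⁺ n))

  labels-≤ : All (_≤ suc n) (toList t)
  labels-≤ = All-resp-↭ (↭-sym labels) (All.map⁺ (All.applyUpTo⁺₁ id n (λ i<n → s≤s (<⇒≤ i<n))))

  #nodes-RB : #nodes t ≡ n
  #nodes-RB = trans (sym (length-toList t)) (trans (↭-length labels) (trans (length-map suc (upTo n)) (length-upTo n)))

  ϑ≡turn : ϑ t ≡ mapₙ (suc n ∸_) (turn t ∅ ∅)
  ϑ≡turn = cong₂ (λ m u → mapₙ (suc m ∸_) u) #nodes-RB (build≡turn t labels-unique)

applyUpTo-∸ : ∀ n → applyUpTo (n ∸_) n ≡ applyDownFrom suc n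
applyUpTo-∸ zero    = refl
applyUpTo-∸ (suc n) = cong (suc n ∷_) (applyUpTo-∸ n)

complement-↭ : ∀ n → List.map (suc n ∸_) (List.map suc (upTo n)) ↭ List.map suc (upTo n)
complement-↭ n = begin
  List.map (suc n ∸_) (List.map suc (upTo n)) ≡⟨ map-∘ (upTo n) ⟨
  List.map (n ∸_) (upTo n)                    ≡⟨ map-upTo (n ∸_) n ⟩
  applyUpTo (n ∸_) n                          ≡⟨ applyUpTo-∸ n ⟩
  applyDownFrom suc n                         ≡⟨ reverse-applyUpTo suc n ⟨
  reverse (applyUpTo suc n)                   ↭⟨ ↭-reverse (applyUpTo suc n) ⟩
  applyUpTo suc n                             ≡⟨ map-upTo suc n ⟨
  List.map suc (upTo n)                       ∎
  where open PermutationReasoning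

ϑ-RB : ∀ {n t} → t ∈ RB n → ϑ t ∈ RB n
ϑ-RB {n} {t} rb = subst (_∈ RB n) (sym (ϑ≡turn rb)) (mkRB
  (begin
    toList (mapₙ (suc n ∸_) (turn t ∅ ∅))       ≡⟨ toList-mapₙ (suc n ∸_) (turn t ∅ ∅) ⟩
    List.map (suc n ∸_) (toList (turn t ∅ ∅))   ↭⟨ ↭.map⁺ (suc n ∸_) (↭-trans (toList-turn-∅ t) (RB.labels rb)) ⟩
    List.map (suc n ∸_) (List.map suc (upTo n)) ↭⟨ complement-↭ n ⟩
    List.map suc (upTo n)                       ∎)
  (rightIncreasing⁺ (rightChildren-complement (suc n) (turn t ∅ ∅)
    (All-resp-↭ (↭-sym (toList-turn-∅ t)) (labels-≤ rb))
    (rightChildren-turn t (rightIncreasing⁻ (RB.right rb)) tt))))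
  where open PermutationReasoning

ϑ-involutive : ∀ {n t} → t ∈ RB n → ϑ (ϑ t) ≡ t
ϑ-involutive {n} {t} rb = begin
  ϑ (ϑ t)                                 ≡⟨ ϑ≡turn (ϑ-RB rb) ⟩
  mapₙ κ (turn (ϑ t) ∅ ∅)                 ≡⟨ cong (λ u → mapₙ κ (turn u ∅ ∅)) (ϑ≡turn rb) ⟩
  mapₙ κ (turn (mapₙ κ (turn t ∅ ∅)) ∅ ∅) ≡⟨ cong (mapₙ κ) (mapₙ-turn κ (turn t ∅ ∅) ∅ ∅) ⟨
  mapₙ κ (mapₙ κ (turn (turn t ∅ ∅) ∅ ∅)) ≡⟨ cong (mapₙ κ ∘ mapₙ κ) (turn-involutive t) ⟩
  mapₙ κ (mapₙ κ t)                       ≡⟨ map-compose {f₁ = κ} {f₂ = κ} {g₁ = id} {g₂ = id} t ⟨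
  mapₙ (κ ∘ κ) t                          ≡⟨ mapₙ-id t (All.map m∸[m∸n]≡n (labels-≤ rb)) ⟩
  t                                       ∎
  where
  open ≡-Reasoning
  κ = suc n ∸_

-- The statistics under φ and ϑ

firstTrue-false : ∀ bs → firstTrue (false ∷ bs) ≡ Maybe.map suc (firstTrue bs)
firstTrue-false bs = trans (sym (Maybe.map-∘ (findIndexᵇ id bs))) (Maybe.map-∘ (findIndexᵇ id bs))

firstTrue-++ : ∀ xs ys → firstTrue (xs ++ ys) ≡ (firstTrue xs <∣> Maybe.map (length xs +_) (firstTrue ys))
firstTrue-++ []           ys = sym (Maybe.map-id (firstTrue ys))
firstTrue-++ (true ∷ xs)  ys = refl
firstTrue-++ (false ∷ xs) ys = begin
  firstTrue (false ∷ xs ++ ys)          ≡⟨ firstTrue-false (xs ++ ys) ⟩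
  Maybe.map suc (firstTrue (xs ++ ys))  ≡⟨ cong (Maybe.map suc) (firstTrue-++ xs ys) ⟩
  Maybe.map suc (firstTrue xs <∣> Maybe.map (length xs +_) (firstTrue ys))
    ≡⟨ Maybe.map-<∣> suc (firstTrue xs) (Maybe.map (length xs +_) (firstTrue ys)) ⟩
  (Maybe.map suc (firstTrue xs) <∣> Maybe.map suc (Maybe.map (length xs +_) (firstTrue ys)))
    ≡⟨ cong (Maybe.map suc (firstTrue xs) <∣>_) (Maybe.map-∘ (firstTrue ys)) ⟨
  (Maybe.map suc (firstTrue xs) <∣> Maybe.map (suc (length xs) +_) (firstTrue ys))
    ≡⟨ cong (_<∣> Maybe.map (suc (length xs) +_) (firstTrue ys)) (firstTrue-false xs) ⟨
  (firstTrue (false ∷ xs) <∣> Maybe.map (suc (length xs) +_) (firstTrue ys)) ∎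
  where open ≡-Reasoning

leftArm : BinTree A → ℕ
leftArm ∅            = 0
leftArm (node l _ _) = suc (leftArm l)

leftArm-mapₙ : ∀ (f : A → B) t → leftArm (mapₙ f t) ≡ leftArm t
leftArm-mapₙ f ∅            = refl
leftArm-mapₙ f (node l _ _) = cong suc (leftArm-mapₙ f l)

larm≡leftArm : ∀ x (ts : Forest A) → larm (node x ts) ≡ leftArm (φ* ts)
larm≡leftArm x []               = refl
larm≡leftArm x (node y cs ∷ ts) = cong suc (larm≡leftArm y cs)

length-toList-marks : ∀ b (t : BinTree A) → length (toList (markRightChildren b t)) ≡ #nodes t
length-toList-marks b t = trans (length-toList (markRightChildren b t)) (#nodes-marks b t)
  where
  #nodes-marks : ∀ b (t : BinTree A) → #nodes (markRightChildren b t) ≡ #nodes t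
  #nodes-marks b ∅            = refl
  #nodes-marks b (node l _ r) = cong₂ (λ m n → m + suc n) (#nodes-marks false l) (#nodes-marks true r)

-- The preorder begins by descending the left arm, and the next node visited, if there is one, is a
-- right child.
spi≡leftArm : ∀ (t : BinTree A) → spi t ≡ leftArm t
spi≡leftArm ∅            = refl
spi≡leftArm (node l x r) = begin
  fromMaybe (#nodes (node l x r)) (firstTrue (toList (markRightChildren false (node l x r))))
    ≡⟨ cong (λ bs → fromMaybe (#nodes (node l x r)) (firstTrue bs)) (toList-node marksˡ false marksʳ) ⟩
  fromMaybe (#nodes (node l x r)) (firstTrue (false ∷ toList marksˡ ++ toList marksʳ))
    ≡⟨ cong (fromMaybe (#nodes (node l x r))) (trans (firstTrue-false (toList marksˡ ++ toList marksʳ))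
         (cong (Maybe.map suc) (firstTrue-++ (toList marksˡ) (toList marksʳ)))) ⟩
  fromMaybe (#nodes (node l x r))
    (Maybe.map suc (firstTrue (toList marksˡ) <∣> Maybe.map (length (toList marksˡ) +_) (firstTrue (toList marksʳ))))
    ≡⟨ first (firstTrue (toList marksˡ)) r ⟩
  suc (spi l)
    ≡⟨ cong suc (spi≡leftArm l) ⟩
  suc (leftArm l) ∎
  where
  open ≡-Reasoning
  marksˡ = markRightChildren false l
  marksʳ = markRightChildren true r
  first : ∀ m (r : BinTree _) →
    fromMaybe (#nodes l + suc (#nodes r))
      (Maybe.map suc (m <∣> Maybe.map (length (toList marksˡ) +_) (firstTrue (toList (markRightChildren true r)))))
    ≡ suc (fromMaybe (#nodes l) m)
  first (just _) r            = refl
  first nothing  ∅            = +-comm (#nodes l) 1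
  -- Here `l` has no right child and is passed completely, so the root of `r` is the first right
  -- child.
  first nothing  (node _ _ _) = cong suc (trans (+-identityʳ _) (length-toList-marks false l))

larm≡spi : ∀ x (ts : Forest A) → larm (node x ts) ≡ spi (φ* ts)
larm≡spi x ts = trans (larm≡leftArm x ts) (sym (spi≡leftArm (φ* ts)))

reversedMarks : BinTree A → List Bool
reversedMarks t = reverse (toList (markHasRightChild t))

length-reversedMarks : (t : BinTree A) → length (reversedMarks t) ≡ #nodes t
length-reversedMarks t = trans (length-reverse (toList (markHasRightChild t)))
  (trans (length-toList (markHasRightChild t)) (#nodes-marks t))
  where
  #nodes-marks : (t : BinTree A) → #nodes (markHasRightChild t) ≡ #nodes t
  #nodes-marks ∅            = refl
  #nodes-marks (node l _ r) = cong₂ (λ m n → m + suc n) (#nodes-marks l) (#nodes-marks r)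

reversedMarks-node : ∀ (l : BinTree A) x r →
  reversedMarks (node l x r) ≡ reversedMarks r ++ reversedMarks l ++ is-just (root? r) ∷ []
reversedMarks-node l x r = begin
  reverse (toList (markHasRightChild (node l x r)))
    ≡⟨ cong reverse (toList-node (markHasRightChild l) b (markHasRightChild r)) ⟩
  reverse (b ∷ toList (markHasRightChild l) ++ toList (markHasRightChild r))
    ≡⟨ unfold-reverse b (toList (markHasRightChild l) ++ toList (markHasRightChild r)) ⟩
  reverse (toList (markHasRightChild l) ++ toList (markHasRightChild r)) ++ b ∷ []
    ≡⟨ cong (_++ b ∷ []) (reverse-++ (toList (markHasRightChild l)) (toList (markHasRightChild r))) ⟩
  (reversedMarks r ++ reversedMarks l) ++ b ∷ []
    ≡⟨ ++-assoc (reversedMarks r) (reversedMarks l) (b ∷ []) ⟩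
  reversedMarks r ++ reversedMarks l ++ b ∷ [] ∎
  where
  open ≡-Reasoning
  b = is-just (root? r)

fromMaybe-<∣> : ∀ (a : ℕ) m m′ → fromMaybe a (m <∣> m′) ≡ fromMaybe (fromMaybe a m′) m
fromMaybe-<∣> a (just _) m′ = refl
fromMaybe-<∣> a nothing  m′ = refl

fromMaybe-+ : ∀ k (a : ℕ) m → fromMaybe (k + a) (Maybe.map (k +_) m) ≡ k + fromMaybe a m
fromMaybe-+ k a (just _) = refl
fromMaybe-+ k a nothing  = refl

-- The search in the second list becomes the default of the search in the first. This nesting
-- matches the accumulator in `leftArm-turn`.
fromMaybe-firstTrue-++ : ∀ a xs ys → fromMaybe (length xs + a) (firstTrue (xs ++ ys)) ≡
                         fromMaybe (length xs + fromMaybe a (firstTrue ys)) (firstTrue xs)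
fromMaybe-firstTrue-++ a xs ys = begin
  fromMaybe (length xs + a) (firstTrue (xs ++ ys))
    ≡⟨ cong (fromMaybe (length xs + a)) (firstTrue-++ xs ys) ⟩
  fromMaybe (length xs + a) (firstTrue xs <∣> Maybe.map (length xs +_) (firstTrue ys))
    ≡⟨ fromMaybe-<∣> (length xs + a) (firstTrue xs) _ ⟩
  fromMaybe (fromMaybe (length xs + a) (Maybe.map (length xs +_) (firstTrue ys))) (firstTrue xs)
    ≡⟨ cong (λ k → fromMaybe k (firstTrue xs)) (fromMaybe-+ (length xs) a (firstTrue ys)) ⟩
  fromMaybe (length xs + fromMaybe a (firstTrue ys)) (firstTrue xs) ∎
  where open ≡-Reasoning

-- The left arm of the result starts at the last node of `t` and runs backwards through the preorder
-- until it meets a node with a right child, which is attached on the right instead. If there is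
-- none, it passes all of `t` and continues into `L`.
leftArm-turn : ∀ (t L R : BinTree A) →
               leftArm (turn t L R) ≡ fromMaybe (#nodes t + leftArm L) (firstTrue (reversedMarks t))
leftArm-turn ∅ L R = refl
leftArm-turn (node l x ∅) L R = begin
  leftArm (turn l (node L x R) ∅)
    ≡⟨ leftArm-turn l (node L x R) ∅ ⟩
  fromMaybe (#nodes l + suc (leftArm L)) (firstTrue (reversedMarks l))
    ≡⟨ cong (λ k → fromMaybe (k + suc (leftArm L)) (firstTrue (reversedMarks l))) (length-reversedMarks l) ⟨
  fromMaybe (length (reversedMarks l) + suc (leftArm L)) (firstTrue (reversedMarks l))
    ≡⟨ fromMaybe-firstTrue-++ (suc (leftArm L)) (reversedMarks l) (false ∷ []) ⟨
  fromMaybe (length (reversedMarks l) + suc (leftArm L)) (firstTrue (reversedMarks l ++ false ∷ []))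
    ≡⟨ cong₂ (λ k bs → fromMaybe k (firstTrue bs))
         (trans (cong (_+ suc (leftArm L)) (length-reversedMarks l)) (sym (+-assoc (#nodes l) 1 (leftArm L))))
         (sym (reversedMarks-node l x ∅)) ⟩
  fromMaybe (#nodes l + 1 + leftArm L) (firstTrue (reversedMarks (node l x ∅))) ∎
  where open ≡-Reasoning
leftArm-turn (node l x r@(node _ _ _)) L R = begin
  leftArm (turn r (turn l ∅ ∅) (node L x R))
    ≡⟨ leftArm-turn r (turn l ∅ ∅) (node L x R) ⟩
  fromMaybe (#nodes r + leftArm (turn l ∅ ∅)) (firstTrue (reversedMarks r))
    ≡⟨ cong₂ (λ k k′ → fromMaybe (k + k′) (firstTrue (reversedMarks r)))
         (sym (length-reversedMarks r)) (trans (leftArm-turn l ∅ ∅) (cong (λ k → fromMaybe k (firstTrue (reversedMarks l)))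
           (cong (_+ 0) (sym (length-reversedMarks l))))) ⟩
  fromMaybe (length (reversedMarks r) + fromMaybe (length (reversedMarks l) + fromMaybe a (firstTrue (true ∷ [])))
    (firstTrue (reversedMarks l))) (firstTrue (reversedMarks r))
    ≡⟨ cong (λ k → fromMaybe (length (reversedMarks r) + k) (firstTrue (reversedMarks r)))
         (fromMaybe-firstTrue-++ a (reversedMarks l) (true ∷ [])) ⟨
  fromMaybe (length (reversedMarks r) + fromMaybe (length (reversedMarks l) + a) (firstTrue (reversedMarks l ++ true ∷ [])))
    (firstTrue (reversedMarks r))
    ≡⟨ fromMaybe-firstTrue-++ (length (reversedMarks l) + a) (reversedMarks r) (reversedMarks l ++ true ∷ []) ⟨
  fromMaybe (length (reversedMarks r) + (length (reversedMarks l) + a))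
    (firstTrue (reversedMarks r ++ reversedMarks l ++ true ∷ []))
    ≡⟨ cong₂ (λ k bs → fromMaybe k (firstTrue bs)) size (sym (reversedMarks-node l x r)) ⟩
  fromMaybe (#nodes l + suc (#nodes r) + leftArm L) (firstTrue (reversedMarks (node l x r))) ∎
  where
  open ≡-Reasoning
  -- The mark `true` of `x` ends its search at 0, the left arm of `∅`; the default `a`, for `x` and
  -- the arm of `L`, makes the sizes add up.
  a = suc (leftArm L)
  size : length (reversedMarks r) + (length (reversedMarks l) + a) ≡ #nodes l + suc (#nodes r) + leftArm L
  size = trans (cong₂ (λ m n → m + (n + a)) (length-reversedMarks r) (length-reversedMarks l))
               (arithmetic (#nodes r) (#nodes l) (leftArm L))
    where
    arithmetic : ∀ m n k → m + (n + suc k) ≡ n + suc m + k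
    arithmetic = solve-∀

spi-turn : (t : BinTree A) → spi (turn t ∅ ∅) ≡ rspi t
spi-turn t = trans (spi≡leftArm (turn t ∅ ∅)) (trans (leftArm-turn t ∅ ∅)
  (cong (λ k → fromMaybe k (firstTrue (reversedMarks t))) (+-identityʳ (#nodes t))))

spi-mapₙ : ∀ (f : A → B) t → spi (mapₙ f t) ≡ spi t
spi-mapₙ f t = trans (spi≡leftArm (mapₙ f t)) (trans (leftArm-mapₙ f t) (sym (spi≡leftArm t)))

-- Under `φ*` the next sibling to the right is the right child, and the two preorders agree.
preorder*-marks : (ts : Forest A) → preorder* (markHasYounger* ts) ≡ toList (markHasRightChild (φ* ts))
preorder*-marks []                              = refl
preorder*-marks (node x cs ∷ [])                = cong (false ∷_)
  (trans (cong (_++ []) (preorder*-marks cs)) (sym (toDiffList-++ (markHasRightChild (φ* cs)) [])))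
preorder*-marks (node x cs ∷ ts@(node _ _ ∷ _)) = cong (true ∷_)
  (trans (cong₂ _++_ (preorder*-marks cs) (preorder*-marks ts))
         (sym (toDiffList-++ (markHasRightChild (φ* cs)) (toList (markHasRightChild (φ* ts))))))

preorder*-φ* : (ts : Forest A) → toList (φ* ts) ≡ preorder* ts
preorder*-φ* []               = refl
preorder*-φ* (node x cs ∷ ts) = trans (toList-node (φ* cs) x (φ* ts))
  (cong (x ∷_) (cong₂ _++_ (preorder*-φ* cs) (preorder*-φ* ts)))

rev≡rspi : ∀ T → rev T ≡ rspi (φ T)
rev≡rspi (node x ts) = begin
  fromMaybe (length (preorder* ts)) (firstTrue (reverse (false ∷ preorder* (markHasYounger* ts))))
    ≡⟨ cong₂ (λ k bs → fromMaybe k (firstTrue (reverse (false ∷ bs))))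
         (trans (cong length (sym (preorder*-φ* ts))) (length-toList (φ* ts))) (preorder*-marks ts) ⟩
  fromMaybe (#nodes t) (firstTrue (reverse (false ∷ toList (markHasRightChild t))))
    -- The mark of the root of the plane tree is `false` and comes last after reversal, so it does
    -- not affect the search.
    ≡⟨ cong (fromMaybe (#nodes t)) (trans (cong firstTrue (unfold-reverse false (toList (markHasRightChild t))))
         (firstTrue-++ (reversedMarks t) (false ∷ []))) ⟩
  fromMaybe (#nodes t) (firstTrue (reversedMarks t) <∣> nothing)
    ≡⟨ cong (fromMaybe (#nodes t)) (<∣>-identityʳ (firstTrue (reversedMarks t))) ⟩
  rspi t ∎
  where
  open ≡-Reasoning
  t = φ* ts

lrb-mapₙ : ∀ (f : A → B) t → lrb (mapₙ f t) ≡ lrb t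
lrb-mapₙ f ∅                                      = refl
lrb-mapₙ f (node _ _ r@(node _ _ _))              = lrb-mapₙ f r
lrb-mapₙ f (node l@(node _ _ _) _ ∅)              = cong suc (lrb-mapₙ f l)
lrb-mapₙ f (node ∅ _ ∅)                           = refl

-- The right boundary of the result runs back along that of `node l x r`, with left and right edges
-- kept, until it reaches `x`; there it continues as the right boundary of `node L x R`.
lrb-turn : ∀ (l : BinTree A) x r L R → lrb (turn (node l x r) L R) ≡ lrb (node l x r) + lrb (node L x R)
lrb-turn ∅                 x ∅ L R = refl
lrb-turn l@(node l₁ y r₁) x ∅ L R = trans (lrb-turn l₁ y r₁ (node L x R) ∅) (+-suc (lrb l) (lrb (node L x R)))
lrb-turn l x r@(node l₁ y r₁) L R = lrb-turn l₁ y r₁ (turn l ∅ ∅) (node L x R)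

-- Moving to the last sibling follows right edges, and each step down is one left edge. The edge at
-- the root of the plane tree has no counterpart, whence `suc`.
rarm≡lrb : ∀ x t (ts : Forest A) → rarm (node x (t ∷ ts)) ≡ suc (lrb (φ* (t ∷ ts)))
rarm≡lrb x (node y [])       []       = refl
rarm≡lrb x (node y (c@(node _ _) ∷ cs)) [] = cong suc (rarm≡lrb y c cs)
rarm≡lrb x (node _ _) (node z ds ∷ us) = rarm≡lrb x (node z ds) us

-- Degrees

rightArm : BinTree A → ℕ
rightArm ∅            = 0
rightArm (node _ _ r) = suc (rightArm r)

-- The children of a node in the plane tree form the right arm that starts at its left child, so
-- `rightArm l` is the degree of the root.
innerDegrees : BinTree A → List ℕ
innerDegrees ∅            = []
innerDegrees (node l _ r) = rightArm l ∷ innerDegrees l ++ innerDegrees r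

length-φ*⁻¹ : (t : BinTree A) → length (φ*⁻¹ t) ≡ rightArm t
length-φ*⁻¹ ∅            = refl
length-φ*⁻¹ (node _ _ r) = cong suc (length-φ*⁻¹ r)

degrees*-φ*⁻¹ : (t : BinTree A) → degrees* (φ*⁻¹ t) ≡ innerDegrees t
degrees*-φ*⁻¹ ∅            = refl
degrees*-φ*⁻¹ (node l _ r) = cong₂ _∷_ (length-φ*⁻¹ l) (cong₂ _++_ (degrees*-φ*⁻¹ l) (degrees*-φ*⁻¹ r))

allDegrees : BinTree A → List ℕ
allDegrees t = rightArm t ∷ innerDegrees t

degrees-φ⁻¹ : ∀ t → degrees (φ⁻¹ t) ≡ allDegrees t
degrees-φ⁻¹ t = cong₂ _∷_ (length-φ*⁻¹ t) (degrees*-φ*⁻¹ t)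

allDegrees-mapₙ : ∀ (f : A → B) t → allDegrees (mapₙ f t) ≡ allDegrees t
allDegrees-mapₙ f t = cong₂ _∷_ (arm t) (inner t)
  where
  arm : ∀ t → rightArm (mapₙ f t) ≡ rightArm t
  arm ∅            = refl
  arm (node _ _ r) = cong suc (arm r)
  inner : ∀ t → innerDegrees (mapₙ f t) ≡ innerDegrees t
  inner ∅            = refl
  inner (node l _ r) = cong₂ _∷_ (arm l) (cong₂ _++_ (inner l) (inner r))

-- Every family of siblings keeps its size, except that R extends the family of
-- the root. The last node of t, a leaf of the plane tree, becomes a parent:
-- this balances the additional 0 on the left.
allDegrees-turn-node : ∀ (l : BinTree A) x r L R →
  0 ∷ allDegrees (turn (node l x r) L R) ↭
  (rightArm (node l x r) + rightArm R) ∷ (innerDegrees (node l x r) ++ (innerDegrees R ++ allDegrees L))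
allDegrees-turn : (t : BinTree A) → allDegrees (turn t ∅ ∅) ↭ allDegrees t
allDegrees-turn ∅            = ↭-refl
-- With `L` empty, `allDegrees L` is a single 0, which cancels the additional one.
allDegrees-turn (node l x r) = drop-∷ (begin
  0 ∷ allDegrees (turn (node l x r) ∅ ∅)
    ↭⟨ allDegrees-turn-node l x r ∅ ∅ ⟩
  (rightArm (node l x r) + 0) ∷ (innerDegrees (node l x r) ++ (0 ∷ []))
    ≡⟨ cong (_∷ (innerDegrees (node l x r) ++ (0 ∷ []))) (+-identityʳ (rightArm (node l x r))) ⟩
  allDegrees (node l x r) ++ (0 ∷ [])
    ↭⟨ ∷↭∷ʳ 0 (allDegrees (node l x r)) ⟨
  0 ∷ allDegrees (node l x r) ∎)
  where open PermutationReasoning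
allDegrees-turn-node ∅ x ∅ L R = begin
  (0 ∷ []) ++ (a ∷ []) ++ allDegrees L ++ innerDegrees R
    ↭⟨ ++-solve 4 (λ z a l r → z ⊕ (a ⊕ (l ⊕ r)) ⊜ a ⊕ (z ⊕ (r ⊕ l))) ↭-refl
         (0 ∷ []) (a ∷ []) (allDegrees L) (innerDegrees R) ⟩
  (a ∷ []) ++ (0 ∷ []) ++ innerDegrees R ++ allDegrees L ∎
  where
  open PermutationReasoning
  a = suc (rightArm R)
allDegrees-turn-node l@(node l₁ y r₁) x ∅ L R = begin
  0 ∷ allDegrees (turn l (node L x R) ∅)
    ↭⟨ allDegrees-turn-node l₁ y r₁ (node L x R) ∅ ⟩
  (rightArm l + 0) ∷ (innerDegrees l ++ (a ∷ (allDegrees L ++ innerDegrees R)))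
    ≡⟨ cong (_∷ (innerDegrees l ++ (a ∷ (allDegrees L ++ innerDegrees R)))) (+-identityʳ (rightArm l)) ⟩
  allDegrees l ++ (a ∷ []) ++ (allDegrees L ++ innerDegrees R)
    ↭⟨ ++-solve 4 (λ z a l r → z ⊕ (a ⊕ (l ⊕ r)) ⊜ a ⊕ (z ⊕ (r ⊕ l))) ↭-refl
         (allDegrees l) (a ∷ []) (allDegrees L) (innerDegrees R) ⟩
  (a ∷ []) ++ allDegrees l ++ innerDegrees R ++ allDegrees L
    ≡⟨ cong (λ ds → (a ∷ []) ++ (rightArm l ∷ ds) ++ innerDegrees R ++ allDegrees L) (++-identityʳ (innerDegrees l)) ⟨
  (a ∷ []) ++ innerDegrees (node l x ∅) ++ innerDegrees R ++ allDegrees L ∎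
  where
  open PermutationReasoning
  a = suc (rightArm R)
allDegrees-turn-node l x r@(node l₁ y r₁) L R = begin
  0 ∷ allDegrees (turn r (turn l ∅ ∅) (node L x R))
    ↭⟨ allDegrees-turn-node l₁ y r₁ (turn l ∅ ∅) (node L x R) ⟩
  (rightArm r + suc (rightArm R)) ∷ (innerDegrees r ++ ((allDegrees L ++ innerDegrees R) ++ allDegrees (turn l ∅ ∅)))
    ≡⟨ cong (_∷ (innerDegrees r ++ ((allDegrees L ++ innerDegrees R) ++ allDegrees (turn l ∅ ∅))))
         (+-suc (rightArm r) (rightArm R)) ⟩
  a ∷ (innerDegrees r ++ ((allDegrees L ++ innerDegrees R) ++ allDegrees (turn l ∅ ∅)))
    ↭⟨ prep a (++⁺ˡ (innerDegrees r) (++⁺ˡ (allDegrees L ++ innerDegrees R) (allDegrees-turn l))) ⟩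
  a ∷ (innerDegrees r ++ ((allDegrees L ++ innerDegrees R) ++ allDegrees l))
    ↭⟨ prep a (++-solve 4 (λ a b c d → a ⊕ ((b ⊕ c) ⊕ d) ⊜ (d ⊕ a) ⊕ (c ⊕ b)) ↭-refl
         (innerDegrees r) (allDegrees L) (innerDegrees R) (allDegrees l)) ⟩
  a ∷ (innerDegrees (node l x r) ++ (innerDegrees R ++ allDegrees L)) ∎
  where
  open PermutationReasoning
  a = suc (rightArm r + rightArm R)

-- The involution on plane trees

spi-ϑ : ∀ {n t} → t ∈ RB n → spi (ϑ t) ≡ rspi t
spi-ϑ {t = t} rb = trans (cong spi (ϑ≡turn rb)) (trans (spi-mapₙ _ (turn t ∅ ∅)) (spi-turn t))

lrb-ϑ : ∀ {n t} → t ∈ RB n → lrb (ϑ t) ≡ lrb t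
lrb-ϑ {t = t} rb = trans (cong lrb (ϑ≡turn rb)) (trans (lrb-mapₙ _ (turn t ∅ ∅)) (untouched t))
  where
  untouched : ∀ (t : BinTree ℕ) → lrb (turn t ∅ ∅) ≡ lrb t
  untouched ∅            = refl
  untouched (node l x r) = trans (lrb-turn l x r ∅ ∅) (+-identityʳ _)

allDegrees-ϑ : ∀ {n t} → t ∈ RB n → allDegrees (ϑ t) ↭ allDegrees t
allDegrees-ϑ {t = t} rb = ↭-trans
  (↭-reflexive (trans (cong allDegrees (ϑ≡turn rb)) (allDegrees-mapₙ _ (turn t ∅ ∅))))
  (allDegrees-turn t)

larm≡spi-φ : ∀ T → larm T ≡ spi (φ T)
larm≡spi-φ (node x ts) = larm≡spi x ts

rarm≡lrb-φ : ∀ {n} → 1 ≤ n → ∀ T → T ∈ LT n → rarm T ≡ lrb (φ T) + 1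
-- For a single node the two sides would be 0 and 1; n ≥ 1 excludes it by counting labels.
rarm≡lrb-φ (s≤s _) (node _ [])       lt = case ↭-length (LT.labels lt) of λ ()
rarm≡lrb-φ _       (node x (t ∷ ts)) lt = trans (rarm≡lrb x t ts) (+-comm 1 (lrb (φ* (t ∷ ts))))

ϑ̃-LT : ∀ {n} T → T ∈ LT n → ϑ̃ T ∈ LT n
ϑ̃-LT T lt = φ⁻¹-LT (ϑ (φ T)) (ϑ-RB (φ-RB T lt))

φ-ϑ̃ : ∀ T → φ (ϑ̃ T) ≡ ϑ (φ T)
φ-ϑ̃ T = φ∘φ⁻¹ (ϑ (φ T))

ϑ̃-involutive : ∀ {n} T → T ∈ LT n → ϑ̃ (ϑ̃ T) ≡ T
ϑ̃-involutive T lt = trans (cong (φ⁻¹ ∘ ϑ) (φ-ϑ̃ T))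
  (trans (cong φ⁻¹ (ϑ-involutive (φ-RB T lt))) (φ⁻¹∘φ T lt))

degreeSequence-ϑ̃ : ∀ {n} T → T ∈ LT n → degreeSequence (ϑ̃ T) ↭ degreeSequence T
degreeSequence-ϑ̃ T lt = filter-↭ (λ d → ¬? (d ≟ 0)) (↭-trans (↭-reflexive (degrees-φ⁻¹ (ϑ (φ T))))
  (↭-trans (allDegrees-ϑ (φ-RB T lt))
    (↭-reflexive (trans (sym (degrees-φ⁻¹ (φ T))) (cong degrees (φ⁻¹∘φ T lt))))))

rarm-ϑ̃ : ∀ {n} → 1 ≤ n → ∀ T → T ∈ LT n → rarm (ϑ̃ T) ≡ rarm T
rarm-ϑ̃ 1≤n T lt = begin
  rarm (ϑ̃ T)          ≡⟨ rarm≡lrb-φ 1≤n (ϑ̃ T) (ϑ̃-LT T lt) ⟩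
  lrb (φ (ϑ̃ T)) + 1   ≡⟨ cong (λ t → lrb t + 1) (φ-ϑ̃ T) ⟩
  lrb (ϑ (φ T)) + 1   ≡⟨ cong (_+ 1) (lrb-ϑ (φ-RB T lt)) ⟩
  lrb (φ T) + 1       ≡⟨ rarm≡lrb-φ 1≤n T lt ⟨
  rarm T              ∎
  where open ≡-Reasoning

larm-ϑ̃ : ∀ {n} T → T ∈ LT n → larm (ϑ̃ T) ≡ rev T
larm-ϑ̃ T lt = begin
  larm (ϑ̃ T)      ≡⟨ larm≡spi-φ (ϑ̃ T) ⟩
  spi (φ (ϑ̃ T))   ≡⟨ cong spi (φ-ϑ̃ T) ⟩
  spi (ϑ (φ T))   ≡⟨ spi-ϑ (φ-RB T lt) ⟩
  rspi (φ T)      ≡⟨ rev≡rspi T ⟨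
  rev T           ∎
  where open ≡-Reasoning

rev-ϑ̃ : ∀ {n} T → T ∈ LT n → rev (ϑ̃ T) ≡ larm T
rev-ϑ̃ T lt = trans (sym (larm-ϑ̃ (ϑ̃ T) (ϑ̃-LT T lt))) (cong larm (ϑ̃-involutive T lt))

-- Transport of the counts

HasSize-φ : ∀ {n} {s : PlaneTree ℕ → ℕ} (s′ : BinTree ℕ → ℕ) {k} → (∀ T → T ∈ LT n → s T ≡ s′ (φ T)) →
  (λ T → T ∈ LT n × s T ≡ k) HasSize c → (λ B → B ∈ RB n × s′ B ≡ k) HasSize c
HasSize-φ s′ s≡s′ = HasSize-bijection φ φ⁻¹
  (λ {T} (lt , eq) → φ-RB T lt , trans (sym (s≡s′ T lt)) eq)
  (λ {B} (rb , eq) → φ⁻¹-LT B rb ,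
    trans (s≡s′ (φ⁻¹ B) (φ⁻¹-LT B rb)) (trans (cong s′ (φ∘φ⁻¹ B)) eq))
  (λ {T} (lt , _) → φ⁻¹∘φ T lt)
  (λ {B} _ → φ∘φ⁻¹ B)

HasSize-larm : ∀ n k → (λ T → T ∈ LT n × larm T ≡ k) HasSize #byArmLength n k
HasSize-larm n k = HasSize-cong
  (λ { {node _ _} (lt@(mkLT refl _ _) , eq) → lt , eq })
  (λ { {node _ _} (lt@(mkLT refl _ _) , eq) → lt , eq })
  (Larm.HasSize-LT n k)

HasSize-rarm : ∀ n k → (λ T → T ∈ LT n × rarm T ≡ k) HasSize #byArmLength n k
HasSize-rarm n k = HasSize-cong
  (λ { {node _ _} (lt@(mkLT refl _ _) , eq) → lt , eq })
  (λ { {node _ _} (lt@(mkLT refl _ _) , eq) → lt , eq })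
  (Rarm.HasSize-LT n k)

-- The involution carries the trees with `larm` equal to `k` onto those with `rev` equal to `k`.
HasSize-rev : ∀ n k → (λ T → T ∈ LT n × rev T ≡ k) HasSize #byArmLength n k
HasSize-rev n k = HasSize-bijection ϑ̃ ϑ̃
  (λ {T} (lt , eq) → ϑ̃-LT T lt , trans (rev-ϑ̃ T lt) eq)
  (λ {T} (lt , eq) → ϑ̃-LT T lt , trans (larm-ϑ̃ T lt) eq)
  (λ {T} (lt , _) → ϑ̃-involutive T lt)
  (λ {T} (lt , _) → ϑ̃-involutive T lt)
  (HasSize-larm n k)

proposition3p15 : (n : ℕ) → 1 ≤ n →
    ((T : PlaneTree ℕ) → T ∈ LT n →
    larm T ≡ spi (φ T) × rev T ≡ rspi (φ T) × rarm T ≡ lrb (φ T) + 1)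
    ×
    ((T : PlaneTree ℕ) → T ∈ LT n →
    ϑ̃ T ∈ LT n
    × ϑ̃ (ϑ̃ T) ≡ T
    × degreeSequence (ϑ̃ T) ↭ degreeSequence T
    × rarm (ϑ̃ T) ≡ rarm T
    × larm (ϑ̃ T) ≡ rev T
    × rev (ϑ̃ T) ≡ larm T)
    ×
    ((𝒯 : ℕ → ℕ → ℚ) → IsTriangle 𝒯 → (k : ℕ) → 1 ≤ k → k ≤ n →
    𝒯 n k Counts (λ B → B ∈ RB n × spi B ≡ k)
    × 𝒯 n k Counts (λ B → B ∈ RB n × rspi B ≡ k)
    × 𝒯 n k Counts (λ T → T ∈ LT n × rev T ≡ k)
    × 𝒯 n k Counts (λ B → B ∈ RB n × lrb B + 1 ≡ k))
proposition3p15 n 1≤n =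
  (λ T lt → larm≡spi-φ T , rev≡rspi T , rarm≡lrb-φ 1≤n T lt) ,
  (λ T lt → ϑ̃-LT T lt , ϑ̃-involutive T lt , degreeSequence-ϑ̃ T lt ,
            rarm-ϑ̃ 1≤n T lt , larm-ϑ̃ T lt , rev-ϑ̃ T lt) ,
  λ 𝒯 isTriangle k 1≤k k≤n → let 𝒯≡ = triangle≡#byArmLength 𝒯 isTriangle n k 1≤k k≤n in
    (_ , HasSize-φ spi (λ T _ → larm≡spi-φ T) (HasSize-larm n k) , 𝒯≡) ,
    (_ , HasSize-φ rspi (λ T _ → rev≡rspi T) (HasSize-rev n k) , 𝒯≡) ,
    (_ , HasSize-rev n k , 𝒯≡) ,
    (_ , HasSize-φ (λ B → lrb B + 1) (rarm≡lrb-φ 1≤n) (HasSize-rarm n k) , 𝒯≡)
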